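{- Let $w\in S_n$, and fix any term order on monomials in $x_1,\ldots,x_n$ satisfying $x_1<x_2<\cdots<x_n$. Then $$\mathbf{x}^{\overline{\mathrm{rajcode}}(w)}=\min\left\{\mathbf{x}^{\overline{\mathrm{wt}}(C,M(C))}\ \middle|\ C\text{ is a heavy climbing chain of }w\right\}.$$ Equivalently, $$\mathbf{x}^{\mathrm{rajcode}(w)}=\max\left\{\mathbf{x}^{\mathrm{wt}(C,M(C))}\ \middle|\ C\text{ is a heavy climbing chain of }w\right\}.$$ Here min and max are taken with respect to the term order.
   Context: Conventions. Permutations are in one-line notation; $t_{ij}$ is the transposition of $i,j$, and $wt_{ij}$ is $w$ with the values in positions $i$ and $j$ exchanged. $w_0\in S_n$ is the longest permutation, $w_0(k)=n+1-k$. The Bruhat order is the transitive closure of $w\le wt_{ij}$ for $i<j$ with $w(i)<w(j)$; $\lessdot$ denotes its cover relation. $\mathbf{x}^v=\prod_k x_k^{v_k}$, $|v|=\sum_k v_k$, and $[n]=\{1,\ldots,n\}$. Climbing chains. A climbing chain of $w\in S_n$ is a sequence $C=(C_1,\ldots,C_m)$ of pairs (links) $C_p=(i_p,j_p)$ with $i_p<j_p$, $i_1\le\cdots\le i_m$, $wt_{i_1j_1}\cdots t_{i_mj_m}=w_0$, and $wt_{i_1j_1}\cdots t_{i_{p-1}j_{p-1}}\lessdot wt_{i_1j_1}\cdots t_{i_pj_p}$ for each $p\in[m]$. (The only climbing chain of $w_0$ is empty. The links of a chain are distinct, so $C$ is also regarded as a set.) The set of minimal markings is $M(C)=\{C_p\mid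 i_{p-1}<i_p,\text{ or } i_{p-1}=i_p\text{ and }j_{p-1}<j_p\}$ with $i_0=0$. For $M(C)\subseteq U\subseteq C$, the dual weight $\overline{\mathrm{wt}}(C,U)\in\mathbb{Z}^n$ has $k$th entry the number of links of the form $(k,\star)$ in $U$, and the weight has $\mathrm{wt}(C,U)_k=n-k-\overline{\mathrm{wt}}(C,U)_k$. Codes. $\overline{\mathrm{rajcode}}(w)_i$ is the maximal number $r$ of positions in a sequence $i=\alpha_1<\cdots<\alpha_r\le n$ with $w(\alpha_1)<\cdots<w(\alpha_r)$, minus one. $\mathrm{rajcode}(w)_k=n-k-\overline{\mathrm{rajcode}}(w)_k$, and $\overline{\mathrm{raj}}(w)=|\overline{\mathrm{rajcode}}(w)|$. A climbing chain $C$ of $w$ is heavy if $\#M(C)=\overline{\mathrm{raj}}(w)$. -}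

module Defs where

open import Data.Fin.Base using (Fin; toℕ; _<_; _≤_)
open import Data.Fin.Permutation using (Permutation′; _⟨$⟩ʳ_; _≈_; transpose; reverse; _∘ₚ_)
open import Data.Fin.Properties using (_≟_; _<?_)
open import Data.List.Base as List using (List; []; _∷_; _++_; length; filter; allFin)
open import Data.List.Extrema.Nat using (max)
open import Data.List.Relation.Unary.All using (All)
open import Data.List.Relation.Unary.Linked using (Linked; linked?)
open import Data.Nat.Base using (ℕ; suc; _+_; _∸_)
open import Data.Product.Base using (_×_; _,_; proj₁; proj₂; ∃-syntax)
open import Data.Sum.Base using (_⊎_)
open import Data.Vec.Base as Vec using (Vec; tabulate; replicate; zipWith; _[_]≔_)
open import Level using (Level) renaming (suc to lsuc)
open import Relation.Binary.Core using (Rel)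
open import Relation.Binary.Construct.Closure.Transitive using (TransClosure)
open import Relation.Binary.Definitions using (Decidable)
open import Relation.Binary.PropositionalEquality.Core using (_≡_; _≢_)
open import Relation.Binary.Structures using (IsTotalOrder)
open import Relation.Nullary.Decidable using (yes; no; _×-dec_; _⊎-dec_)
open import Relation.Nullary.Negation using (¬_)
open import Relation.Unary using (Pred)

private
  variable
    a ℓ ℓ′ : Level
    n : ℕ

-- Positions and values are 0-based: the element k of {1,…,n} is represented by
-- the element of Fin n whose toℕ is k - 1.  Permutations are compared
-- pointwise (_≈_).

Link : ℕ → Set
Link n = Fin n × Fin n

-- π₁ ∘ₚ π₂ applies π₁ first, so this exchanges the values in positions i and j.
_·_ : Permutation′ n → Link n → Permutation′ n
w · (i , j) = transpose i j ∘ₚ w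

w₀ : Permutation′ n
w₀ = reverse

infix 4 _⟶_ _<ᴮ_ _⋖_

_⟶_ : Rel (Permutation′ n) _
u ⟶ v = ∃[ i ] ∃[ j ] i < j × u ⟨$⟩ʳ i < u ⟨$⟩ʳ j × v ≈ u · (i , j)

-- The strict Bruhat order: every step u ⟶ v changes the permutation and
-- increases the number of inversions.
_<ᴮ_ : Rel (Permutation′ n) _
_<ᴮ_ = TransClosure _⟶_

_⋖_ : Rel (Permutation′ n) _
u ⋖ v = u <ᴮ v × ¬ (∃[ z ] u <ᴮ z × z <ᴮ v)

Saturated : Permutation′ n → List (Link n) → Set
Saturated w []       = w ≈ w₀
Saturated w (l ∷ ls) = w ⋖ (w · l) × Saturated (w · l) ls

record ClimbingChain (w : Permutation′ n) : Set where
  field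
    links     : List (Link n)
    ordered   : All (λ l → proj₁ l < proj₂ l) links
    climbing  : Linked (λ l l′ → proj₁ l ≤ proj₁ l′) links
    saturated : Saturated w links

open ClimbingChain public

Marks : Rel (Link n) _
Marks (i′ , j′) (i , j) = i′ < i ⊎ (i′ ≡ i × j′ < j)

marks? : Decidable (Marks {n})
marks? (i′ , j′) (i , j) = (i′ <? i) ⊎-dec ((i′ ≟ i) ×-dec (j′ <? j))

markedAfter : Link n → List (Link n) → List (Link n)
markedAfter l′ []       = []
markedAfter l′ (l ∷ ls) with marks? l′ l
... | yes _ = l ∷ markedAfter l ls
... | no  _ = markedAfter l ls

-- The convention i₀ = 0 (below every 1-based position) marks the first link.
markedLinks : List (Link n) → List (Link n)
markedLinks []       = []
markedLinks (l ∷ ls) = l ∷ markedAfter l ls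

-- The set M(C), as a sublist of the links of C.  As the links of a chain are
-- distinct, the length of the list is the cardinality of the set.
M : {w : Permutation′ n} → ClimbingChain w → List (Link n)
M C = markedLinks (links C)

-- v ↦ (n - k - vₖ)ₖ, where the 1-based k is suc (toℕ k).  The subtraction is
-- never truncated where it is used: an increasing sequence of positions
-- starting at k has at most n - k further terms, and a climbing chain has at
-- most n - k links (k , ⋆), since each of them decreases the number of
-- positions to the right of k holding a larger value than position k.
complement : Vec ℕ n → Vec ℕ n
complement {n} v = tabulate λ k → n ∸ suc (toℕ k) ∸ Vec.lookup v k

-- The (dual) weight of (C , U) depends only on the set of marked links U.
dualWeight : List (Link n) → Vec ℕ n
dualWeight U = tabulate λ k → length (filter (λ l → proj₁ l ≟ k) U)

weight : List (Link n) → Vec ℕ n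
weight U = complement (dualWeight U)

sublists : {A : Set a} → List A → List (List A)
sublists []       = [] ∷ []
sublists (x ∷ xs) = List.map (x ∷_) (sublists xs) ++ sublists xs

Ascent : Permutation′ n → Rel (Fin n) _
Ascent w α β = α < β × w ⟨$⟩ʳ α < w ⟨$⟩ʳ β

ascent? : (w : Permutation′ n) → Decidable (Ascent w)
ascent? w α β = (α <? β) ×-dec (w ⟨$⟩ʳ α <? w ⟨$⟩ʳ β)

-- All sequences i = α₁ < ⋯ < αᵣ with w(α₁) < ⋯ < w(αᵣ): the tail of such a
-- sequence is a sublist of the increasing list of all positions.
increasingFrom : Permutation′ n → Fin n → List (List (Fin n))
increasingFrom {n} w i =
  filter (linked? (ascent? w)) (List.map (i ∷_) (sublists (allFin n)))

dualRajcode : Permutation′ n → Vec ℕ n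
dualRajcode w = tabulate λ i → max 0 (List.map length (increasingFrom w i)) ∸ 1

rajcode : Permutation′ n → Vec ℕ n
rajcode w = complement (dualRajcode w)

dualRaj : Permutation′ n → ℕ
dualRaj w = Vec.sum (dualRajcode w)

Heavy : {w : Permutation′ n} → ClimbingChain w → Set
Heavy {w = w} C = length (M C) ≡ dualRaj w

-- A monomial in x₁,…,xₙ is represented by its exponent vector, so that
-- multiplication of monomials is addition of vectors.
Monomial : ℕ → Set
Monomial n = Vec ℕ n

𝟙 : Monomial n
𝟙 = replicate _ 0

x : Fin n → Monomial n
x i = 𝟙 [ i ]≔ 1

_⊗_ : Monomial n → Monomial n → Monomial n
_⊗_ = zipWith _+_

record TermOrder (n : ℕ) (ℓ : Level) : Set (lsuc ℓ) where
  infix 4 _≼_ _≺_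
  field
    _≼_          : Rel (Monomial n) ℓ
    isTotalOrder : IsTotalOrder _≡_ _≼_
    𝟙-least      : ∀ p → 𝟙 ≼ p
    ⊗-monoˡ      : ∀ {p q} r → p ≼ q → (p ⊗ r) ≼ (q ⊗ r)

  _≺_ : Rel (Monomial n) ℓ
  p ≺ q = p ≼ q × p ≢ q

IsMin : {A : Set a} → Rel A ℓ → Pred A ℓ′ → A → Set _
IsMin _≤_ P m = P m × (∀ p → P p → m ≤ p)

IsMax : {A : Set a} → Rel A ℓ → Pred A ℓ′ → A → Set _
IsMax _≤_ P m = P m × (∀ p → P p → p ≤ m)

heavyDualWeights : Permutation′ n → Pred (Monomial n) _
heavyDualWeights w p = ∃[ C ] Heavy {w = w} C × p ≡ dualWeight (M C)

heavyWeights : Permutation′ n → Pred (Monomial n) _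
heavyWeights w p = ∃[ C ] Heavy {w = w} C × p ≡ weight (M C)

{-# OPTIONS --safe #-}

-- Write R w i for the entry i of the dual rajcode of w.  It is determined by
-- R w k < R w i for every ascent i < k, w(i) < w(k), with equality R w i = 1 + R w k
-- for some such k unless R w i = 0.  A link (i , j) of a climbing chain is a
-- cover, so it preserves all ascents between positions right of i, and R can
-- only grow there.  Between two marks the j decrease, and comparing R at i and
-- at j before and after the exchange shows that one mark lowers the total of R
-- by at most one.  Hence in every climbing chain each suffix sum of the dual
-- weight is at least the corresponding suffix sum of R.  For heavy chains the
-- totals agree, and moving exponents to larger variables gives the inequality
-- of monomials.
--
-- Equality is attained by the chain that always uses the first position i with
-- R w i > 0 and the rightmost j with R w i = 1 + R w j over an ascent (i , j):
-- such a link does not increase R, and R at i drops before each further mark.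
-- The statement for the maximum follows by taking complements.
module Submission where

open import Defs
open import Data.Fin.Base using (Fin; zero; suc; toℕ; _<_; _≤_)
open import Data.Fin.Induction using (<-wellFounded; >-wellFounded)
open import Data.Fin.Permutation using (Permutation′; _⟨$⟩ʳ_; _≈_)
import Data.Fin.Permutation.Components as PC
open import Data.Fin.Properties as Fin using (_≟_; _<?_; any?; toℕ<n; toℕ-injective)
open import Data.List.Base as List using (List; []; _∷_; length; filter; allFin)
open import Data.List.Extrema.Nat using (max; argmax-sel; v≤max⁺)
open import Data.List.Membership.Propositional using (_∈_; lose)
open import Data.List.Membership.Propositional.Properties
  using (∈-map⁺; ∈-map⁻; ∈-++⁺ˡ; ∈-++⁺ʳ; ∈-filter⁺; ∈-filter⁻; ∈-allFin)
open import Data.List.Relation.Unary.All as All using (All; []; _∷_)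
open import Data.List.Relation.Unary.AllPairs as AllPairs using (AllPairs; []; _∷_)
open import Data.List.Relation.Unary.AllPairs.Properties using (tabulate⁺-<)
open import Data.List.Relation.Unary.Any using (here; there)
open import Data.List.Relation.Unary.Linked as Linked using (Linked; []; [-]; _∷_; linked?)
open import Data.List.Relation.Unary.Linked.Properties using (Linked⇒All; Linked⇒AllPairs)
open import Data.Nat.Base as ℕ using (ℕ; zero; suc; _+_; _∸_; _*_; z≤n; s≤s)
import Data.Nat.Induction as ℕ
import Data.Nat.Properties as ℕ
open import Data.Nat.Tactic.RingSolver using (solve-∀)
open import Data.Product.Base using (_×_; _,_; proj₁; proj₂; ∃-syntax)
open import Data.Sum.Base using (_⊎_; inj₁; inj₂)
open import Data.Vec.Base as Vec using ([]; _∷_; tabulate)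
open import Data.Vec.Functional using (updateAt)
open import Data.Vec.Functional.Properties using (updateAt-updates; updateAt-minimal)
open import Data.Vec.Properties
  using (zipWith-assoc; zipWith-comm; zipWith-identityˡ; tabulate-cong; lookup∘tabulate)
open import Function.Base using (_∘_; id; const; flip)
open import Function.Bundles using (Injection)
open import Function.Properties.Inverse using (↔⇒↣)
open import Induction.WellFounded using (Acc; acc; WellFounded)
open import Level using (Level; 0ℓ)
open import Relation.Binary.Construct.Closure.Transitive using ([_]; _∷_; _++_)
open import Relation.Binary.Core using (Rel)
open import Relation.Binary.Definitions using (Decidable; tri<; tri≈; tri>)
open import Relation.Binary.PropositionalEquality
  using (_≡_; _≢_; refl; sym; trans; cong; cong₂; subst; subst₂)
open import Relation.Binary.Structures using (IsTotalOrder)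
open import Relation.Nullary.Decidable
  using (Dec; yes; no; ¬?; _×-dec_; dec-true; dec-false; decidable-stable)
open import Relation.Nullary.Negation using (¬_; contradiction)
import Relation.Unary as Unary

private
  variable
    ℓ : Level
    m n : ℕ
    P Q : Set

-- Suffix sums and term orders

total : (Fin n → ℕ) → ℕ
total f = Vec.sum (tabulate f)

total-mono : ∀ {n} {f g : Fin n → ℕ} → (∀ k → f k ℕ.≤ g k) → total f ℕ.≤ total g
total-mono {zero}  f≤g = z≤n
total-mono {suc n} f≤g = ℕ.+-mono-≤ (f≤g zero) (total-mono (f≤g ∘ suc))

total-cong : ∀ {n} {f g : Fin n → ℕ} → (∀ k → f k ≡ g k) → total f ≡ total g
total-cong {zero}  f≡g = refl
total-cong {suc n} f≡g = cong₂ _+_ (f≡g zero) (total-cong (f≡g ∘ suc))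

total-+ : ∀ {n} (f g : Fin n → ℕ) → total (λ k → f k + g k) ≡ total f + total g
total-+ {zero}  f g = refl
total-+ {suc n} f g =
  trans (cong (f zero + g zero +_) (total-+ (f ∘ suc) (g ∘ suc)))
        (interchange (f zero) (g zero) _ _)
  where
  interchange : ∀ a b c d → a + b + (c + d) ≡ a + c + (b + d)
  interchange = solve-∀

pointwise-≡ : ∀ {n} {f g : Fin n → ℕ} → (∀ k → f k ℕ.≤ g k) → total g ℕ.≤ total f →
              ∀ k → f k ≡ g k
pointwise-≡ {suc n} {f} {g} f≤g Σg≤Σf zero = ℕ.≤-antisym (f≤g zero)
  (ℕ.+-cancelʳ-≤ _ _ _ (ℕ.≤-trans Σg≤Σf (ℕ.+-monoʳ-≤ (f zero) (total-mono (f≤g ∘ suc)))))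
pointwise-≡ {suc n} {f} {g} f≤g Σg≤Σf (suc k) = pointwise-≡ (f≤g ∘ suc)
  (ℕ.+-cancelˡ-≤ _ _ _ (ℕ.≤-trans Σg≤Σf (ℕ.+-monoˡ-≤ _ (f≤g zero)))) k

-- The constants `a` and `b` carry what `total-transfer` has already collected at the smaller of its
-- two exceptional indices.
total-transfer₁ : ∀ {n} {f g : Fin n → ℕ} {a b} i → (∀ k → k ≢ i → f k ℕ.≤ g k) →
                  a + f i ℕ.≤ b + g i → a + total f ℕ.≤ b + total g
total-transfer₁ {suc n} {f} {g} {a} {b} zero f≤g h =
  subst₂ ℕ._≤_ (ℕ.+-assoc a _ _) (ℕ.+-assoc b _ _)
    (ℕ.+-mono-≤ h (total-mono λ k → f≤g (suc k) λ ()))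
total-transfer₁ {suc n} {f} {g} {a} {b} (suc i) f≤g h =
  subst₂ ℕ._≤_ (swap (f zero) a _) (swap (g zero) b _)
    (ℕ.+-mono-≤ (f≤g zero λ ())
      (total-transfer₁ {a = a} {b} i (λ k k≢i → f≤g (suc k) λ { refl → k≢i refl }) h))
  where
  swap : ∀ x y z → x + (y + z) ≡ y + (x + z)
  swap = solve-∀

-- An exchange affects two entries only, so comparing their sums suffices; `a` is a guaranteed gain.
-- Suffix sums, ranks and `energy` all rely on this.
total-transfer : ∀ {n} {f g : Fin n → ℕ} {a} {i j} → i < j →
                 (∀ k → k ≢ i → k ≢ j → f k ℕ.≤ g k) →
                 a + (f i + f j) ℕ.≤ g i + g j → a + total f ℕ.≤ total g
total-transfer {suc n} {f} {g} {a} {zero} {suc j} _ f≤g h =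
  subst (ℕ._≤ g zero + total (g ∘ suc)) (ℕ.+-assoc a _ _)
  (total-transfer₁ {a = a + f zero} {g zero} j
    (λ k k≢j → f≤g (suc k) (λ ()) λ { refl → k≢j refl })
    (subst (ℕ._≤ g zero + g (suc j)) (sym (ℕ.+-assoc a _ _)) h))
total-transfer {suc n} {f} {g} {a} {suc i} {suc j} (s≤s i<j) f≤g h =
  subst (ℕ._≤ g zero + total (g ∘ suc)) (swap (f zero) a _)
  (ℕ.+-mono-≤ (f≤g zero (λ ()) λ ())
    (total-transfer {a = a} i<j
      (λ k k≢i k≢j → f≤g (suc k) (λ { refl → k≢i refl }) λ { refl → k≢j refl }) h))
  where
  swap : ∀ x y z → x + (y + z) ≡ y + (x + z)
  swap = solve-∀

-- Every suffix sum of the left-hand side is at most that of the right-hand side.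
infix 4 _⊴_

data _⊴_ : (f g : Fin n → ℕ) → Set where
  []  : {f g : Fin 0 → ℕ} → f ⊴ g
  _∷_ : {f g : Fin (suc n) → ℕ} → total f ℕ.≤ total g → (f ∘ suc) ⊴ (g ∘ suc) → f ⊴ g

⊴-total : {f g : Fin n → ℕ} → f ⊴ g → total f ℕ.≤ total g
⊴-total []      = z≤n
⊴-total (h ∷ _) = h

⊴-pointwise : ∀ {n} {f g : Fin n → ℕ} → (∀ k → f k ℕ.≤ g k) → f ⊴ g
⊴-pointwise {zero}  f≤g = []
⊴-pointwise {suc n} f≤g = total-mono f≤g ∷ ⊴-pointwise (f≤g ∘ suc)

⊴-trans : {f g h : Fin n → ℕ} → f ⊴ g → g ⊴ h → f ⊴ h
⊴-trans []      []        = []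
⊴-trans (p ∷ d) (p′ ∷ d′) = ℕ.≤-trans p p′ ∷ ⊴-trans d d′

⊴-+ˡ : (h : Fin n → ℕ) {f g : Fin n → ℕ} → f ⊴ g → (λ k → h k + f k) ⊴ (λ k → h k + g k)
⊴-+ˡ h []      = []
⊴-+ˡ h {f} {g} (p ∷ d) =
  subst₂ ℕ._≤_ (sym (total-+ h f)) (sym (total-+ h g)) (ℕ.+-monoʳ-≤ (total h) p)
  ∷ ⊴-+ˡ (h ∘ suc) d

-- The entry of `f` at `i` may exceed that of `g`. Every suffix containing `i` also contains `j`,
-- where the excess is paid back; the other suffixes compare pointwise.
⊴-transfer : ∀ {n} {f g : Fin n → ℕ} {i j} → i < j →
             (∀ k → k ≢ i → f k ℕ.≤ g k) → f i + f j ℕ.≤ g i + g j → f ⊴ g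
⊴-transfer {suc n} {f} {g} {zero} {suc j} 0<j f≤g h =
  total-transfer {a = 0} 0<j (λ k k≢i _ → f≤g k k≢i) h
  ∷ ⊴-pointwise (λ k → f≤g (suc k) λ ())
⊴-transfer {suc n} {f} {g} {suc i} {suc j} (s≤s i<j) f≤g h =
  total-transfer {f = f} {g} {a = 0} (s≤s i<j) (λ k k≢i _ → f≤g k k≢i) h
  ∷ ⊴-transfer i<j (λ k k≢i → f≤g (suc k) λ { refl → k≢i refl }) h

-- Monomials as exponent vectors

⊗-assoc : (p q r : Monomial n) → (p ⊗ q) ⊗ r ≡ p ⊗ (q ⊗ r)
⊗-assoc = zipWith-assoc ℕ.+-assoc

⊗-comm : (p q : Monomial n) → p ⊗ q ≡ q ⊗ p
⊗-comm = zipWith-comm ℕ.+-comm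

⊗-identityˡ : (p : Monomial n) → 𝟙 ⊗ p ≡ p
⊗-identityˡ = zipWith-identityˡ ℕ.+-identityˡ

⊗-cancelˡ : (r p q : Monomial n) → r ⊗ p ≡ r ⊗ q → p ≡ q
⊗-cancelˡ []      []      []      _ = refl
⊗-cancelˡ (c ∷ r) (a ∷ p) (b ∷ q) eq =
  cong₂ _∷_ (ℕ.+-cancelˡ-≡ c a b (cong Vec.head eq)) (⊗-cancelˡ r p q (cong Vec.tail eq))

infixr 8 _^_

_^_ : Monomial n → ℕ → Monomial n
y ^ zero  = 𝟙
y ^ suc a = y ⊗ (y ^ a)

^-+ : (y : Monomial n) (a b : ℕ) → y ^ (a + b) ≡ (y ^ a) ⊗ (y ^ b)
^-+ y zero    b = sym (⊗-identityˡ _)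
^-+ y (suc a) b = trans (cong (y ⊗_) (^-+ y a b)) (sym (⊗-assoc y _ _))

-- The family `y` is arbitrary so that induction can remove variables one at a time while the
-- monomials, and with them the term order, stay in `n` variables.
eval : (Fin m → Monomial n) → (Fin m → ℕ) → Monomial n
eval {zero}  y f = 𝟙
eval {suc m} y f = (y zero ^ f zero) ⊗ eval (y ∘ suc) (f ∘ suc)

∷-^ : (y : Monomial n) (a : ℕ) → (0 ∷ y) ^ a ≡ 0 ∷ (y ^ a)
∷-^ y zero    = refl
∷-^ y (suc a) = cong ((0 ∷ y) ⊗_) (∷-^ y a)

head-^ : (a : ℕ) → x {suc n} zero ^ a ≡ a ∷ 𝟙
head-^ zero    = refl
head-^ (suc a) = trans (cong (x zero ⊗_) (head-^ a)) (cong (suc a ∷_) (⊗-identityˡ 𝟙))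

eval-∷ : ∀ {m} (y : Fin m → Monomial n) (f : Fin m → ℕ) →
         eval (λ k → 0 ∷ y k) f ≡ 0 ∷ eval y f
eval-∷ {m = zero}  y f = refl
eval-∷ {m = suc m} y f = cong₂ _⊗_ (∷-^ (y zero) (f zero)) (eval-∷ (y ∘ suc) (f ∘ suc))

eval-x : ∀ {n} (f : Fin n → ℕ) → eval x f ≡ tabulate f
eval-x {zero}  f = refl
eval-x {suc n} f =
  trans (cong₂ _⊗_ (head-^ (f zero)) (eval-∷ x (f ∘ suc)))
        (cong₂ _∷_ (ℕ.+-identityʳ _) (trans (⊗-identityˡ _) (eval-x (f ∘ suc))))

tabulate-⊗ : ∀ {n} (f g : Fin n → ℕ) → tabulate f ⊗ tabulate g ≡ tabulate (λ k → f k + g k)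
tabulate-⊗ {zero}  f g = refl
tabulate-⊗ {suc n} f g = cong (f zero + g zero ∷_) (tabulate-⊗ (f ∘ suc) (g ∘ suc))

⊗-complement : (f : Fin n → ℕ) → (∀ k → f k ℕ.≤ n ∸ suc (toℕ k)) →
               tabulate f ⊗ complement (tabulate f) ≡ tabulate (λ k → n ∸ suc (toℕ k))
⊗-complement {n} f f≤ = trans (tabulate-⊗ f _) (tabulate-cong λ k →
  trans (cong (λ a → f k + (n ∸ suc (toℕ k) ∸ a)) (lookup∘tabulate f k)) (ℕ.m+[n∸m]≡n (f≤ k)))

module _ (T : TermOrder n ℓ) where
  open TermOrder T
  private module ≼ = IsTotalOrder isTotalOrder

  ⊗-monoʳ : ∀ r {p q} → p ≼ q → (r ⊗ p) ≼ (r ⊗ q)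
  ⊗-monoʳ r {p} {q} p≼q = subst₂ _≼_ (⊗-comm p r) (⊗-comm q r) (⊗-monoˡ r p≼q)

  -- By totality the only other case is `q ≼ p`; multiplying by `r` then makes the two products
  -- equal, and exponent vectors cancel.
  ≼-cancelˡ : ∀ r {p q} → (r ⊗ p) ≼ (r ⊗ q) → p ≼ q
  ≼-cancelˡ r {p} {q} rp≼rq with ≼.total p q
  ... | inj₁ p≼q = p≼q
  ... | inj₂ q≼p =
    ≼.reflexive (⊗-cancelˡ r p q (≼.antisym rp≼rq (⊗-monoʳ r q≼p)))

  ^-mono : ∀ {y z} a → y ≼ z → (y ^ a) ≼ (z ^ a)
  ^-mono zero    y≼z = ≼.refl
  ^-mono {y} (suc a) y≼z = ≼.trans (⊗-monoʳ y (^-mono a y≼z)) (⊗-monoˡ _ y≼z)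

  -- z ^ c is the surplus of f over g at the smaller variables already treated;
  -- it is moved to the next variable, which is larger.
  eval-surplus : ∀ {m} {y : Fin m → Monomial n} {f g : Fin m → ℕ} {z} c →
                 (∀ k → z ≼ y k) → (∀ {i j} → i < j → y i ≼ y j) →
                 c + total f ≡ total g → f ⊴ g → ((z ^ c) ⊗ eval y f) ≼ eval y g
  eval-surplus {zero} zero _ _ _ _ = ≼.reflexive (⊗-identityˡ 𝟙)
  eval-surplus {suc m} {y} {f} {g} {z} c z≼y y-mono eq (_ ∷ f⊴g) = ≼.trans
    (⊗-monoˡ _ (^-mono c (z≼y zero)))
    (subst (_≼ eval y g) (sym regroup)
      (⊗-monoʳ _ (eval-surplus d (λ k → y-mono (s≤s z≤n)) (y-mono ∘ s≤s) rest f⊴g)))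
    where
    a = f zero
    b = g zero
    Y = y zero
    E = eval (y ∘ suc) (f ∘ suc)
    eq′ : c + a + total (f ∘ suc) ≡ b + total (g ∘ suc)
    eq′ = trans (ℕ.+-assoc c a _) eq
    -- The new surplus `d` is a genuine difference: the totals agree once `c` is added, and `g` has
    -- at least as much as `f` on the remaining variables.
    b≤c+a : b ℕ.≤ c + a
    b≤c+a = ℕ.+-cancelʳ-≤ (total (g ∘ suc)) _ _
      (ℕ.≤-trans (ℕ.≤-reflexive (sym eq′)) (ℕ.+-monoʳ-≤ (c + a) (⊴-total f⊴g)))
    d = c + a ∸ b
    b+d : b + d ≡ c + a
    b+d = ℕ.m+[n∸m]≡n b≤c+a
    rest : d + total (f ∘ suc) ≡ total (g ∘ suc)
    rest = ℕ.+-cancelˡ-≡ b _ _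
      (trans (sym (ℕ.+-assoc b d _)) (trans (cong (_+ total (f ∘ suc)) b+d) eq′))
    regroup : (Y ^ c) ⊗ ((Y ^ a) ⊗ E) ≡ (Y ^ b) ⊗ ((Y ^ d) ⊗ E)
    regroup = trans (sym (⊗-assoc (Y ^ c) _ _))
      (trans (cong (_⊗ E) (trans (sym (^-+ Y c a)) (trans (cong (Y ^_) (sym b+d)) (^-+ Y b d))))
             (⊗-assoc (Y ^ b) _ _))

  ⊴⇒≼ : (∀ {i j} → i < j → x i ≼ x j) → {f g : Fin n → ℕ} →
        total f ≡ total g → f ⊴ g → tabulate f ≼ tabulate g
  ⊴⇒≼ x-mono {f} {g} eq f⊴g = subst₂ _≼_
    (trans (⊗-identityˡ _) (eval-x f)) (eval-x g)
    -- There is no surplus yet, and `𝟙` serves as the smaller variable.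
    (eval-surplus 0 (λ _ → 𝟙-least _) x-mono eq f⊴g)

  -- Multiplying `F ≼ G` by both complements turns the sides into the staircase times the complement
  -- of `G`, respectively of `F`; then the staircase cancels.
  complement-anti : ∀ {f g : Fin n → ℕ} →
    (∀ k → f k ℕ.≤ n ∸ suc (toℕ k)) → (∀ k → g k ℕ.≤ n ∸ suc (toℕ k)) →
    tabulate f ≼ tabulate g → complement (tabulate g) ≼ complement (tabulate f)
  complement-anti {f} {g} f≤ g≤ f≼g = ≼-cancelˡ stairs (subst₂ _≼_
    (trans (sym (⊗-assoc F _ _)) (cong (_⊗ complement G) (⊗-complement f f≤)))
    (trans (cong (G ⊗_) (⊗-comm (complement F) _))
      (trans (sym (⊗-assoc G _ _)) (cong (_⊗ complement F) (⊗-complement g g≤))))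
    (⊗-monoˡ (complement F ⊗ complement G) f≼g))
    where
    F = tabulate f
    G = tabulate g
    stairs = tabulate λ k → n ∸ suc (toℕ k)

-- The dual rajcode

infix 9 _!_

_!_ : Permutation′ n → Fin n → Fin n
w ! i = w ⟨$⟩ʳ i

R : Permutation′ n → Fin n → ℕ
R w i = max 0 (List.map length (increasingFrom w i)) ∸ 1

-- Ensures that `increasingFrom` misses no sequence. The head of `xs` is kept exactly when it is the
-- head of `ys`; strictness puts the other entries of `ys` into the tail of `xs`.
sorted-∈-sublists : {xs ys : List (Fin n)} → AllPairs _<_ xs → AllPairs _<_ ys →
                    All (_∈ xs) ys → ys ∈ sublists xs
sorted-∈-sublists {xs = []} [] [] [] = here refl
sorted-∈-sublists {xs = []} [] (_ ∷ _) (() ∷ _)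
sorted-∈-sublists {xs = x ∷ xs} (x< ∷ <xs) [] [] =
  ∈-++⁺ʳ (List.map (x ∷_) (sublists xs)) (sorted-∈-sublists <xs [] [])
sorted-∈-sublists {xs = x ∷ xs} (x< ∷ <xs) (y< ∷ <ys) (here refl ∷ ys∈) =
  ∈-++⁺ˡ (∈-map⁺ (x ∷_) (sorted-∈-sublists <xs <ys (All.zipWith drop (y< , ys∈))))
  where
  drop : ∀ {z} → x < z × z ∈ x ∷ xs → z ∈ xs
  drop (x<z , here refl) = contradiction refl (Fin.<⇒≢ x<z)
  drop (x<z , there z∈)  = z∈
sorted-∈-sublists {xs = x ∷ xs} (x< ∷ <xs) (y< ∷ <ys) (there y∈ ∷ ys∈) =
  ∈-++⁺ʳ (List.map (x ∷_) (sublists xs))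
    (sorted-∈-sublists <xs (y< ∷ <ys) (y∈ ∷ All.zipWith drop (y< , ys∈)))
  where
  drop : ∀ {z} → _ < z × z ∈ x ∷ xs → z ∈ xs
  drop (y<z , here refl) = contradiction refl (Fin.<⇒≢ (Fin.<-trans (All.lookup x< y∈) y<z))
  drop (y<z , there z∈)  = z∈

∈-increasingFrom⁺ : (w : Permutation′ n) {i : Fin n} {ks : List (Fin n)} →
                    Linked (Ascent w) (i ∷ ks) → i ∷ ks ∈ increasingFrom w i
∈-increasingFrom⁺ w {i} {ks} inc =
  ∈-filter⁺ (linked? (ascent? w))
    (∈-map⁺ (i ∷_) (sorted-∈-sublists (tabulate⁺-< id)
      (AllPairs.tail (Linked⇒AllPairs Fin.<-trans (Linked.map proj₁ inc)))
      (All.tabulate λ _ → ∈-allFin _)))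
    inc

∈-increasingFrom⁻ : (w : Permutation′ n) {i : Fin n} {xs : List (Fin n)} →
                    xs ∈ increasingFrom w i → ∃[ ks ] xs ≡ i ∷ ks × Linked (Ascent w) (i ∷ ks)
∈-increasingFrom⁻ w {i} xs∈
  with ∈-filter⁻ (linked? (ascent? w)) {xs = List.map (i ∷_) (sublists (allFin _))} xs∈
... | xs∈′ , inc with ∈-map⁻ (i ∷_) xs∈′
...   | ks , _ , refl = ks , refl , inc

R-upper : (w : Permutation′ n) {i : Fin n} {ks : List (Fin n)} →
          Linked (Ascent w) (i ∷ ks) → length ks ℕ.≤ R w i
R-upper w inc = ℕ.∸-monoˡ-≤ 1
  (v≤max⁺ 0 _ (inj₂ (lose (∈-map⁺ length (∈-increasingFrom⁺ w inc)) ℕ.≤-refl)))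

R-attained : (w : Permutation′ n) (i : Fin n) →
             ∃[ ks ] Linked (Ascent w) (i ∷ ks) × R w i ≡ length ks
R-attained w i with argmax-sel id 0 (List.map length (increasingFrom w i))
-- For the default value of `max`, truncation gives `0 ∸ 1 = 0`, the tail length of the sequence
-- consisting of `i` alone.
... | inj₁ eq = [] , [-] , cong (_∸ 1) eq
... | inj₂ m∈ with ∈-map⁻ length m∈
...   | xs , xs∈ , eq with ∈-increasingFrom⁻ w xs∈
...     | ks , refl , inc = ks , inc , cong (_∸ 1) eq

R-ascent : (w : Permutation′ n) {i k : Fin n} → Ascent w i k → R w k ℕ.< R w i
R-ascent w {i} {k} asc with R-attained w k
... | ks , inc , eq = subst (ℕ._< R w i) (sym eq) (R-upper w (asc ∷ inc))

-- Take the second term of a longest sequence from `i`. Together with `R-ascent` this recursion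
-- carries all later estimates of `R`.
R-next : (w : Permutation′ n) (i : Fin n) →
         R w i ≡ 0 ⊎ ∃[ k ] Ascent w i k × R w i ≡ suc (R w k)
R-next w i with R-attained w i
... | []     , _         , eq = inj₁ eq
... | k ∷ ks , asc ∷ inc , eq = inj₂ (k , asc , ℕ.≤-antisym
  (subst (ℕ._≤ suc (R w k)) (sym eq) (s≤s (R-upper w inc))) (R-ascent w asc))

-- Covers in the Bruhat order

!-injective : (w : Permutation′ n) {i j : Fin n} → w ! i ≡ w ! j → i ≡ j
!-injective w = Injection.injective (↔⇒↣ w)

transpose-fst : (i j : Fin n) → PC.transpose i j i ≡ j
transpose-fst i j rewrite dec-true (i ≟ i) refl = refl

transpose-snd : (i j : Fin n) → PC.transpose i j j ≡ i
transpose-snd i j with j ≟ i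
... | yes j≡i = j≡i
... | no  _ rewrite dec-true (j ≟ j) refl = refl

transpose-other : {i j k : Fin n} → k ≢ i → k ≢ j → PC.transpose i j k ≡ k
transpose-other {i = i} {j} {k} k≢i k≢j
  rewrite dec-false (k ≟ i) k≢i | dec-false (k ≟ j) k≢j = refl

·-fst : (w : Permutation′ n) (i j : Fin n) → (w · (i , j)) ! i ≡ w ! j
·-fst w i j = cong (w !_) (transpose-fst i j)

·-snd : (w : Permutation′ n) (i j : Fin n) → (w · (i , j)) ! j ≡ w ! i
·-snd w i j = cong (w !_) (transpose-snd i j)

·-other : (w : Permutation′ n) {i j k : Fin n} → k ≢ i → k ≢ j → (w · (i , j)) ! k ≡ w ! k
·-other w k≢i k≢j = cong (w !_) (transpose-other k≢i k≢j)

-- The rearrangement inequality with its defect made explicit. Strict changes of `rank` and of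
-- `energy` come from this product being positive.
rearrange : ∀ {a b x y} → b ℕ.≤ a → x ℕ.≤ y →
            (a ∸ b) * (y ∸ x) + (a * x + b * y) ≡ a * y + b * x
rearrange {a} {b} {x} {y} b≤a x≤y = subst₂
  (λ a′ y′ → (a ∸ b) * (y ∸ x) + (a′ * x + b * y′) ≡ a′ * y′ + b * x)
  (ℕ.m+[n∸m]≡n b≤a) (ℕ.m+[n∸m]≡n x≤y) (expand (a ∸ b) b (y ∸ x) x)
  where
  expand : ∀ e b d x → e * d + ((b + e) * x + b * (x + d)) ≡ (b + e) * (x + d) + b * x
  expand = solve-∀

⟦_⟧ : Dec P → ℕ
⟦ yes _ ⟧ = 1
⟦ no  _ ⟧ = 0

⟦⟧-mono : (P? : Dec P) (Q? : Dec Q) → (P → Q) → ⟦ P? ⟧ ℕ.≤ ⟦ Q? ⟧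
⟦⟧-mono (no  _) _       _   = z≤n
⟦⟧-mono (yes _) (yes _) _   = ℕ.≤-refl
⟦⟧-mono (yes p) (no ¬q) P→Q = contradiction (P→Q p) ¬q

⟦⟧-cong : (P? : Dec P) (Q? : Dec Q) → (P → Q) → (Q → P) → ⟦ P? ⟧ ≡ ⟦ Q? ⟧
⟦⟧-cong P? Q? P→Q Q→P = ℕ.≤-antisym (⟦⟧-mono P? Q? P→Q) (⟦⟧-mono Q? P? Q→P)

⟦⟧-strict : (P? : Dec P) (Q? : Dec Q) → ¬ P → Q → ⟦ P? ⟧ ℕ.< ⟦ Q? ⟧
⟦⟧-strict (yes p) _       ¬p q = contradiction p ¬p
⟦⟧-strict (no  _) (yes _) ¬p q = ℕ.≤-refl
⟦⟧-strict (no  _) (no ¬q) ¬p q = contradiction q ¬q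

-- The rank matrix of the Bruhat order criterion, as a sum of products of indicators so that
-- `rearrange` computes the effect of an exchange.
rank : Permutation′ n → ℕ → ℕ → ℕ
rank w p q = total λ k → ⟦ toℕ k ℕ.<? p ⟧ * ⟦ q ℕ.≤? toℕ (w ! k) ⟧

rank-cong : (u v : Permutation′ n) → u ≈ v → ∀ p q → rank u p q ≡ rank v p q
rank-cong u v u≈v p q = total-cong λ k →
  cong (λ a → ⟦ toℕ k ℕ.<? p ⟧ * ⟦ q ℕ.≤? toℕ a ⟧) (u≈v k)

module Swap (u : Permutation′ n) {i j : Fin n} (i<j : i < j) (ui<uj : u ! i < u ! j) where

  private
    v = u · (i , j)
    φ : ℕ → Fin n → ℕ
    φ p k = ⟦ toℕ k ℕ.<? p ⟧
    ψ : ℕ → Fin n → ℕ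
    ψ q a = ⟦ q ℕ.≤? toℕ a ⟧

    φ-anti : ∀ p → φ p j ℕ.≤ φ p i
    φ-anti p = ⟦⟧-mono (toℕ j ℕ.<? p) (toℕ i ℕ.<? p) (ℕ.<-trans i<j)

    ψ-mono : ∀ q → ψ q (u ! i) ℕ.≤ ψ q (u ! j)
    ψ-mono q = ⟦⟧-mono (q ℕ.≤? toℕ (u ! i)) (q ℕ.≤? toℕ (u ! j))
                        (λ q≤ → ℕ.<⇒≤ (ℕ.≤-<-trans q≤ ui<uj))

  rank-gain : ∀ p q → (φ p i ∸ φ p j) * (ψ q (u ! j) ∸ ψ q (u ! i)) + rank u p q ℕ.≤ rank v p q
  rank-gain p q = total-transfer {a = (φ p i ∸ φ p j) * _} i<j
    (λ k k≢i k≢j → ℕ.≤-reflexive (cong (λ a → φ p k * ψ q a) (sym (·-other u k≢i k≢j))))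
    (subst₂ (λ a b → (φ p i ∸ φ p j) * (ψ q (u ! j) ∸ ψ q (u ! i)) +
                     (φ p i * ψ q (u ! i) + φ p j * ψ q (u ! j))
                     ℕ.≤ φ p i * ψ q a + φ p j * ψ q b)
      (sym (·-fst u i j)) (sym (·-snd u i j))
      (ℕ.≤-reflexive (rearrange (φ-anti p) (ψ-mono q))))

  rank-mono : ∀ p q → rank u p q ℕ.≤ rank v p q
  rank-mono p q = ℕ.≤-trans (ℕ.m≤n+m _ _) (rank-gain p q)

  rank-strict : ∀ {p q} → toℕ i ℕ.< p → p ℕ.≤ toℕ j → toℕ (u ! i) ℕ.< q → q ℕ.≤ toℕ (u ! j) →
                rank u p q ℕ.< rank v p q
  rank-strict {p} {q} i<p p≤j ui<q q≤uj = ℕ.≤-trans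
    (ℕ.+-monoˡ-≤ (rank u p q) (ℕ.*-mono-≤
      (ℕ.m<n⇒0<n∸m (⟦⟧-strict (toℕ j ℕ.<? p) (toℕ i ℕ.<? p) (ℕ.≤⇒≯ p≤j) i<p))
      (ℕ.m<n⇒0<n∸m (⟦⟧-strict (q ℕ.≤? toℕ (u ! i)) (q ℕ.≤? toℕ (u ! j)) (ℕ.<⇒≱ ui<q) q≤uj))))
    (rank-gain p q)

  private
    unchanged : ∀ p q → φ p i ≡ φ p j ⊎ ψ q (u ! i) ≡ ψ q (u ! j) → rank v p q ℕ.≤ rank u p q
    unchanged p q same = total-transfer {a = 0} i<j
      (λ k k≢i k≢j → ℕ.≤-reflexive (cong (λ a → φ p k * ψ q a) (·-other u k≢i k≢j)))
      (subst₂ (λ a b → φ p i * ψ q a + φ p j * ψ q b ℕ.≤ φ p i * ψ q (u ! i) + φ p j * ψ q (u ! j))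
        (sym (·-fst u i j)) (sym (·-snd u i j)) (ℕ.≤-reflexive (equal same)))
      where
      equal : φ p i ≡ φ p j ⊎ ψ q (u ! i) ≡ ψ q (u ! j) →
              φ p i * ψ q (u ! j) + φ p j * ψ q (u ! i) ≡ φ p i * ψ q (u ! i) + φ p j * ψ q (u ! j)
      equal (inj₁ eq) rewrite eq = ℕ.+-comm (φ p j * ψ q (u ! j)) _
      equal (inj₂ eq) rewrite eq = refl

  -- Outside the rectangle one factor of the defect vanishes, and `unchanged` applies.
  rank-strict⁻ : ∀ {p q} → rank u p q ℕ.< rank v p q →
                 (toℕ i ℕ.< p × p ℕ.≤ toℕ j) × (toℕ (u ! i) ℕ.< q × q ℕ.≤ toℕ (u ! j))
  rank-strict⁻ {p} {q} lt = (i<p , p≤j) , (ui<q , q≤uj)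
    where
    by : φ p i ≡ φ p j ⊎ ψ q (u ! i) ≡ ψ q (u ! j) → {A : Set} → A
    by same = contradiction lt (ℕ.≤⇒≯ (unchanged p q same))
    i<p : toℕ i ℕ.< p
    i<p with toℕ i ℕ.<? p
    ... | yes i<p = i<p
    ... | no  i≮p = by (inj₁ (⟦⟧-cong (toℕ i ℕ.<? p) (toℕ j ℕ.<? p)
                       (λ i<p → contradiction i<p i≮p) (ℕ.<-trans i<j)))
    p≤j : p ℕ.≤ toℕ j
    p≤j with toℕ j ℕ.<? p
    ... | no  j≮p = ℕ.≮⇒≥ j≮p
    ... | yes j<p = by (inj₁ (⟦⟧-cong (toℕ i ℕ.<? p) (toℕ j ℕ.<? p)
                       (λ _ → j<p) (ℕ.<-trans i<j)))
    ui<q : toℕ (u ! i) ℕ.< q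
    ui<q with q ℕ.≤? toℕ (u ! i)
    ... | no  q≰ = ℕ.≰⇒> q≰
    ... | yes q≤ = by (inj₂ (⟦⟧-cong (q ℕ.≤? toℕ (u ! i)) (q ℕ.≤? toℕ (u ! j))
                      (λ _ → ℕ.≤-trans q≤ (ℕ.<⇒≤ ui<uj)) (λ _ → q≤)))
    q≤uj : q ℕ.≤ toℕ (u ! j)
    q≤uj with q ℕ.≤? toℕ (u ! j)
    ... | yes q≤ = q≤
    ... | no  q≰ = by (inj₂ (⟦⟧-cong (q ℕ.≤? toℕ (u ! i)) (q ℕ.≤? toℕ (u ! j))
                      (λ q≤ → ℕ.≤-trans q≤ (ℕ.<⇒≤ ui<uj)) (λ q≤ → contradiction q≤ q≰)))

⟶-rank : (u v : Permutation′ n) → u ⟶ v → ∀ p q → rank u p q ℕ.≤ rank v p q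
⟶-rank u v (i , j , i<j , ui<uj , v≈) p q =
  ℕ.≤-trans (Swap.rank-mono u i<j ui<uj p q) (ℕ.≤-reflexive (sym (rank-cong v (u · (i , j)) v≈ p q)))

<ᴮ-rank : {u v : Permutation′ n} → u <ᴮ v → ∀ p q → rank u p q ℕ.≤ rank v p q
<ᴮ-rank {u = u} {v} [ u⟶v ] p q = ⟶-rank u v u⟶v p q
<ᴮ-rank {u = u} (_∷_ {y = z} u⟶z z<v) p q = ℕ.≤-trans (⟶-rank u z u⟶z p q) (<ᴮ-rank z<v p q)

⟶-rank-< : (u v : Permutation′ n) → u ⟶ v → ∃[ p ] ∃[ q ] rank u p q ℕ.< rank v p q
⟶-rank-< u v (i , j , i<j , ui<uj , v≈) = suc (toℕ i) , toℕ (u ! j) ,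
  ℕ.<-≤-trans (Swap.rank-strict u i<j ui<uj ℕ.≤-refl i<j ui<uj ℕ.≤-refl)
              (ℕ.≤-reflexive (sym (rank-cong v (u · (i , j)) v≈ (suc (toℕ i)) (toℕ (u ! j)))))

<ᴮ-rank-< : {u v : Permutation′ n} → u <ᴮ v → ∃[ p ] ∃[ q ] rank u p q ℕ.< rank v p q
<ᴮ-rank-< {u = u} {v} [ u⟶v ] = ⟶-rank-< u v u⟶v
<ᴮ-rank-< {u = u} (_∷_ {y = z} u⟶z z<v) with ⟶-rank-< u z u⟶z
... | p , q , lt = p , q , ℕ.<-≤-trans lt (<ᴮ-rank z<v p q)

-- Covers as empty rectangles

Between : Permutation′ n → Link n → Fin n → Set
Between u (i , j) k = (i < k × k < j) × (u ! i < u ! k × u ! k < u ! j)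

-- If `u ! j < u ! i`, exchanging back is an upward step to `u`, so no rank can grow from `u` to
-- `u · (i , j)`, against `<ᴮ-rank-<`.
⋖⇒ascent : (u : Permutation′ n) {i j : Fin n} → i < j → u ⋖ (u · (i , j)) → u ! i < u ! j
⋖⇒ascent u {i} {j} i<j (u<v , _) with Fin.<-cmp (u ! i) (u ! j)
... | tri< ui<uj _ _ = ui<uj
... | tri≈ _ eq _    = contradiction (!-injective u eq) (Fin.<⇒≢ i<j)
... | tri> _ _ uj<ui = contradiction lt (ℕ.≤⇒≯ (⟶-rank v u v⟶u p q))
  where
  v = u · (i , j)
  v⟶u : v ⟶ u
  v⟶u = i , j , i<j , subst₂ _<_ (sym (·-fst u i j)) (sym (·-snd u i j)) uj<ui , back
    where
    back : u ≈ v · (i , j)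
    back k = by-cases (k ≟ i) (k ≟ j)
      where
      by-cases : Dec (k ≡ i) → Dec (k ≡ j) → u ! k ≡ (v · (i , j)) ! k
      by-cases (yes refl) _          = sym (trans (·-fst v i j) (·-snd u i j))
      by-cases (no _)     (yes refl) = sym (trans (·-snd v i j) (·-fst u i j))
      by-cases (no k≢i)   (no k≢j)   = sym (trans (·-other v k≢i k≢j) (·-other u k≢i k≢j))
  p = proj₁ (<ᴮ-rank-< u<v)
  q = proj₁ (proj₂ (<ᴮ-rank-< u<v))
  lt = proj₂ (proj₂ (<ᴮ-rank-< u<v))

-- At positions i < k < j the values a < b < c pass through b a c and c a b to c b a.
⋖⇒¬between : (u : Permutation′ n) {i j : Fin n} → u ⋖ (u · (i , j)) → ∀ k → ¬ Between u (i , j) k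
⋖⇒¬between u {i} {j} (_ , minimal) k ((i<k , k<j) , (a<b , b<c)) =
  minimal (z , [ i , k , i<k , a<b , (λ _ → refl) ] ,
           _∷_ {y = y} (i , j , i<j , subst₂ _<_ (sym z-i) (sym z-j) b<c , λ _ → refl)
             [ k , j , k<j , subst₂ _<_ (sym y-k) (sym y-j) a<b , done ])
  where
  i<j = ℕ.<-trans i<k k<j
  i≢k = Fin.<⇒≢ i<k
  i≢j = Fin.<⇒≢ i<j
  k≢j = Fin.<⇒≢ k<j
  z = u · (i , k)
  y = z · (i , j)
  z-i = ·-fst u i k
  z-j = ·-other u (i≢j ∘ sym) (k≢j ∘ sym)
  y-k = trans (·-other z (i≢k ∘ sym) k≢j) (·-snd u i k)
  y-j = trans (·-snd z i j) z-i
  y-i = trans (·-fst z i j) z-j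
  done : (u · (i , j)) ≈ (y · (k , j))
  done l = by-cases (l ≟ i) (l ≟ j) (l ≟ k)
    where
    by-cases : Dec (l ≡ i) → Dec (l ≡ j) → Dec (l ≡ k) → (u · (i , j)) ! l ≡ (y · (k , j)) ! l
    by-cases (yes refl) _ _ = trans (·-fst u i j) (sym (trans (·-other y i≢k i≢j) y-i))
    by-cases (no _) (yes refl) _ = trans (·-snd u i j) (sym (trans (·-snd y k j) y-k))
    by-cases (no _) (no _) (yes refl) = trans (·-other u (i≢k ∘ sym) k≢j) (sym (trans (·-fst y k j) y-j))
    by-cases (no l≢i) (no l≢j) (no l≢k) = trans (·-other u l≢i l≢j)
      (sym (trans (·-other y l≢k l≢j) (trans (·-other z l≢i l≢j) (·-other u l≢i l≢k))))

-- The first step towards an intermediate element already arrives at `v` by `first-step`; a further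
-- strict chain ending in `v` would have to increase some rank.
¬between⇒⋖ : (u : Permutation′ n) {i j : Fin n} → i < j → u ! i < u ! j →
             (∀ k → ¬ Between u (i , j) k) → u ⋖ (u · (i , j))
¬between⇒⋖ u {i} {j} i<j ui<uj empty = [ i , j , i<j , ui<uj , (λ _ → refl) ] , minimal
  where
  v = u · (i , j)

  -- A first step inside the rectangle spanned by (i , j) joins two of its
  -- points, and there are only the two corners.
  first-step : ∀ z → u ⟶ z → (∀ p q → rank z p q ℕ.≤ rank v p q) → z ≈ v
  first-step z (a , b , a<b , ua<ub , z≈) z≤v = λ k → trans (z≈ k)
    (cong₂ (λ a b → (u · (a , b)) ! k) a≡i b≡j)
    where
    inside : ∀ {p q} → toℕ a ℕ.< p → p ℕ.≤ toℕ b → toℕ (u ! a) ℕ.< q → q ℕ.≤ toℕ (u ! b) →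
             (toℕ i ℕ.< p × p ℕ.≤ toℕ j) × (toℕ (u ! i) ℕ.< q × q ℕ.≤ toℕ (u ! j))
    inside {p} {q} h₁ h₂ h₃ h₄ = Swap.rank-strict⁻ u i<j ui<uj
      (ℕ.<-≤-trans (Swap.rank-strict u a<b ua<ub h₁ h₂ h₃ h₄)
        (ℕ.≤-trans (ℕ.≤-reflexive (sym (rank-cong z (u · (a , b)) z≈ p q))) (z≤v p q)))
    near = inside ℕ.≤-refl a<b ℕ.≤-refl ua<ub
    far  = inside a<b ℕ.≤-refl ua<ub ℕ.≤-refl
    a≡i : a ≡ i
    a≡i with a ≟ i
    ... | yes a≡i = a≡i
    ... | no  a≢i = contradiction
      ( (ℕ.≤∧≢⇒< (ℕ.s≤s⁻¹ (proj₁ (proj₁ near))) (λ eq → a≢i (sym (toℕ-injective eq)))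
        , proj₂ (proj₁ near))
      , (ℕ.≤∧≢⇒< (ℕ.s≤s⁻¹ (proj₁ (proj₂ near))) (λ eq → a≢i (sym (!-injective u (toℕ-injective eq))))
        , proj₂ (proj₂ near)))
      (empty a)
    b≡j : b ≡ j
    b≡j with b ≟ j
    ... | yes b≡j = b≡j
    ... | no  b≢j = contradiction
      ( (proj₁ (proj₁ far) , ℕ.≤∧≢⇒< (proj₂ (proj₁ far)) (λ eq → b≢j (toℕ-injective eq)))
      , (proj₁ (proj₂ far) , ℕ.≤∧≢⇒< (proj₂ (proj₂ far)) (λ eq → b≢j (!-injective u (toℕ-injective eq)))))
      (empty b)

  irrefl : ∀ z → z ≈ v → ¬ (z <ᴮ v)
  irrefl z z≈v z<v with <ᴮ-rank-< z<v
  ... | p , q , lt = ℕ.<⇒≢ lt (rank-cong z v z≈v p q)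

  minimal : ¬ (∃[ z ] u <ᴮ z × z <ᴮ v)
  minimal (z , [ u⟶z ] , z<v) = irrefl z (first-step z u⟶z (<ᴮ-rank z<v)) z<v
  minimal (z , (_∷_ {y = y} u⟶y y<z) , z<v) = irrefl y (first-step y u⟶y (<ᴮ-rank y<v)) y<v
    where
    y<v = y<z ++ z<v

-- The lower bound for all climbing chains

≮∧≢⇒> : {i j : Fin n} → ¬ (i < j) → i ≢ j → j < i
≮∧≢⇒> i≮j i≢j = ℕ.≤∧≢⇒< (ℕ.≮⇒≥ i≮j) (λ eq → i≢j (sym (toℕ-injective eq)))

R≡0 : (w : Permutation′ n) {i : Fin n} → (∀ k → ¬ Ascent w i k) → R w i ≡ 0
R≡0 w {i} none with R-next w i
... | inj₁ eq            = eq
... | inj₂ (k , asc , _) = contradiction asc (none k)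

-- The surplus t left at position i after a link (i , j): either the loss of
-- one allowed by the last mark is still available, or t is attained by
-- increasing sequences from i that continue to the right of j.
Admissible : Permutation′ n → Link n → ℕ → Set
Admissible w (i , j) t =
  t ℕ.≤ R w i ∸ 1 ⊎ ∃[ k ] j < k × Ascent w i k × t ℕ.≤ suc (R w k)

Admissible⇒≤R : (w : Permutation′ n) {i j : Fin n} {t : ℕ} → Admissible w (i , j) t → t ℕ.≤ R w i
Admissible⇒≤R w (inj₁ t≤)                 = ℕ.≤-trans t≤ (ℕ.m∸n≤m _ 1)
Admissible⇒≤R w (inj₂ (k , _ , asc , t≤)) = ℕ.≤-trans t≤ (R-ascent w asc)

_[_↦_] : (Fin n → ℕ) → Fin n → ℕ → Fin n → ℕ
f [ i ↦ t ] = updateAt f i (const t)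

↦-≤ : {f : Fin n → ℕ} {i : Fin n} {t : ℕ} → t ℕ.≤ f i → ∀ k → (f [ i ↦ t ]) k ℕ.≤ f k
↦-≤ {f = f} {i} t≤ k with k ≟ i
... | yes refl = subst (ℕ._≤ f i) (sym (updateAt-updates i f)) t≤
... | no  k≢i  = ℕ.≤-reflexive (updateAt-minimal k i f k≢i)

δ : Fin n → Fin n → ℕ
δ i k = ⟦ i ≟ k ⟧

δ-refl : (i : Fin n) → δ i i ≡ 1
δ-refl i with i ≟ i
... | yes _  = refl
... | no i≢i = contradiction refl i≢i

count : List (Link n) → Fin n → ℕ
count ls k = length (filter (λ l → proj₁ l ≟ k) ls)

count-∷ : (l : Link n) (ls : List (Link n)) (k : Fin n) → count (l ∷ ls) k ≡ δ (proj₁ l) k + count ls k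
count-∷ l ls k with proj₁ l ≟ k
... | yes _ = refl
... | no  _ = refl

module CoverStep (w : Permutation′ n) {i j : Fin n} (i<j : i < j) (cover : w ⋖ (w · (i , j))) where

  private
    v = w · (i , j)
    wi<wj = ⋖⇒ascent w i<j cover
    empty = ⋖⇒¬between w cover
    j≢i : j ≢ i
    j≢i = Fin.<⇒≢ i<j ∘ sym

  ascent-past : ∀ {k} → i < k → Ascent w k j → Ascent v k j
  ascent-past {k} i<k (k<j , wk<wj) = k<j ,
    subst₂ _<_ (sym (·-other w (Fin.<⇒≢ i<k ∘ sym) (Fin.<⇒≢ k<j))) (sym (·-snd w i j))
      (≮∧≢⇒> (λ wi<wk → empty k ((i<k , k<j) , (wi<wk , wk<wj)))
              (Fin.<⇒≢ i<k ∘ !-injective w))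

  ascent-after : ∀ {k} → j < k → w ! i < w ! k → Ascent v j k
  ascent-after j<k wi<wk = j<k ,
    subst₂ _<_ (sym (·-snd w i j))
      (sym (·-other w (Fin.<⇒≢ (Fin.<-trans i<j j<k) ∘ sym) (Fin.<⇒≢ j<k ∘ sym))) wi<wk

  ascent-start : ∀ {k} → k ≢ j → i < k → w ! j < w ! k → Ascent v i k
  ascent-start k≢j i<k wj<wk = i<k ,
    subst₂ _<_ (sym (·-fst w i j)) (sym (·-other w (Fin.<⇒≢ i<k ∘ sym) k≢j)) wj<wk

  -- Right of `i` only the value at `j` changes, dropping to `w ! i`. Ascents ending at `j` are at
  -- risk, and the empty rectangle saves them.
  ascent-preserved : ∀ {p k} → i < p → Ascent w p k → Ascent v p k
  ascent-preserved {p} {k} i<p asc@(p<k , wp<wk) = by-cases (p ≟ j) (k ≟ j)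
    where
    i<k = Fin.<-trans i<p p<k
    by-cases : Dec (p ≡ j) → Dec (k ≡ j) → Ascent v p k
    by-cases (yes refl) _          = ascent-after p<k (Fin.<-trans wi<wj wp<wk)
    by-cases (no _)     (yes refl) = ascent-past i<p asc
    by-cases (no p≢j)   (no k≢j)   = p<k ,
      subst₂ _<_ (sym (·-other w (Fin.<⇒≢ i<p ∘ sym) p≢j))
                 (sym (·-other w (Fin.<⇒≢ i<k ∘ sym) k≢j)) wp<wk

  R-grows : ∀ {p} → i < p → R w p ℕ.≤ R v p
  R-grows {p} = go (>-wellFounded p)
    where
    go : ∀ {p} → Acc (λ a b → b < a) p → i < p → R w p ℕ.≤ R v p
    go {p} (acc rs) i<p with R-next w p
    ... | inj₁ eq = subst (ℕ._≤ R v p) (sym eq) z≤n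
    ... | inj₂ (k , asc@(p<k , _) , eq) = subst (ℕ._≤ R v p) (sym eq)
      (ℕ.≤-<-trans (go (rs p<k) (Fin.<-trans i<p p<k)) (R-ascent v (ascent-preserved i<p asc)))

  -- After the exchange `i` holds the old value of `j`, so an increasing sequence from `j` can start
  -- at `i` instead and continues right of `j`.
  Rj-admissible : Admissible v (i , j) (R w j)
  Rj-admissible with R-next w j
  ... | inj₁ eq = inj₁ (subst (ℕ._≤ R v i ∸ 1) (sym eq) z≤n)
  ... | inj₂ (k , (j<k , wj<wk) , eq) = inj₂ (k , j<k ,
    ascent-start (Fin.<⇒≢ j<k ∘ sym) (Fin.<-trans i<j j<k) wj<wk ,
    subst (ℕ._≤ suc (R v k)) (sym eq) (s≤s (R-grows (Fin.<-trans i<j j<k))))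

  R-after : ∀ {k} → j < k → Ascent w i k → suc (R w k) ℕ.≤ R v j
  R-after j<k (_ , wi<wk) = ℕ.≤-<-trans (R-grows (Fin.<-trans i<j j<k)) (R-ascent v (ascent-after j<k wi<wk))

  -- Let `k` follow `i` in a longest sequence. If `k` lies right of `j`, the sequence can start at
  -- `j` after the exchange. If `k` is `j`, exactly one is lost. If `k` lies left of `j`, the empty
  -- rectangle forces `w ! j < w ! k`, so `k` still follows `i`.
  R-drop : ∃[ t ] Admissible v (i , j) t × R w i + R w j ℕ.≤ suc t + R v j
  R-drop with R-next w i
  ... | inj₁ eq = 0 , inj₁ z≤n ,
    subst (λ a → a + R w j ℕ.≤ suc (R v j)) (sym eq) (ℕ.≤-trans (R-grows i<j) (ℕ.n≤1+n _))
  ... | inj₂ (k , asc@(i<k , wi<wk) , eq) with Fin.<-cmp k j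
  ...   | tri> _ _ j<k = R w j , Rj-admissible ,
    ℕ.≤-trans (ℕ.≤-reflexive (ℕ.+-comm (R w i) _)) (ℕ.+-mono-≤ (ℕ.n≤1+n (R w j))
      (subst (ℕ._≤ R v j) (sym eq) (R-after j<k asc)))
  ...   | tri≈ _ refl _ = R w j , Rj-admissible ,
    ℕ.+-mono-≤ (ℕ.≤-reflexive eq) (R-grows i<j)
  ...   | tri< k<j k≢j _ = R w k ,
    inj₁ (ℕ.∸-monoˡ-≤ 1 (ℕ.≤-<-trans (R-grows i<k) (R-ascent v (ascent-start k≢j i<k wj<wk)))) ,
    ℕ.+-mono-≤ (ℕ.≤-reflexive eq) (R-grows i<j)
    where
    wj<wk = ≮∧≢⇒> (λ wk<wj → empty k ((i<k , k<j) , (wi<wk , wk<wj))) (k≢j ∘ !-injective w)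

  -- A sequence continuing right of `j₀` also lies right of `j`, so it moves to `j` without loss.
  -- Otherwise `t` is already one below `R w i`, which pays for the loss in `R-drop`.
  R-keep : ∀ {j₀ t} → j ≤ j₀ → Admissible w (i , j₀) t →
           ∃[ t′ ] Admissible v (i , j) t′ × t + R w j ℕ.≤ t′ + R v j
  R-keep j≤j₀ (inj₂ (k , j₀<k , asc , t≤)) = R w j , Rj-admissible ,
    ℕ.≤-trans (ℕ.+-monoˡ-≤ (R w j) (ℕ.≤-trans t≤ (R-after (ℕ.≤-<-trans j≤j₀ j₀<k) asc)))
              (ℕ.≤-reflexive (ℕ.+-comm (R v j) _))
  R-keep {t = t} j≤j₀ (inj₁ t≤) with R w i | R-drop
  -- Here `R w i ∸ 1` is truncated, so `t` is zero.
  ... | zero  | _ = 0 , inj₁ z≤n , ℕ.+-mono-≤ t≤ (R-grows i<j)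
  ... | suc r | t′ , adm , drop = t′ , adm ,
    ℕ.≤-trans (ℕ.+-monoˡ-≤ (R w j) t≤) (ℕ.s≤s⁻¹ drop)

  module _ (low : ∀ p → p < i → R w p ≡ 0) where

    private
      R-other : ∀ {t} k → k ≢ i → R w k ℕ.≤ (R v [ i ↦ t ]) k
      R-other k k≢i = subst (R w k ℕ.≤_) (sym (updateAt-minimal k i (R v) k≢i)) grows
        where
        grows : R w k ℕ.≤ R v k
        grows with Fin.<-cmp k i
        ... | tri< k<i _ _ = subst (ℕ._≤ R v k) (sym (low k k<i)) z≤n
        ... | tri≈ _ k≡i _ = contradiction k≡i k≢i
        ... | tri> _ _ i<k = R-grows i<k

    -- The mark supplies `δ i`. Whatever else `i` loses reappears at `j`, further right, as suffix
    -- sums require.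
    marked-step : ∃[ t ] Admissible v (i , j) t × R w ⊴ (λ k → δ i k + (R v [ i ↦ t ]) k)
    marked-step with R-drop
    ... | t , adm , drop = t , adm , ⊴-transfer i<j
      (λ k k≢i → ℕ.m≤n⇒m≤o+n (δ i k) (R-other k k≢i))
      (ℕ.≤-trans drop (ℕ.+-mono-≤
        (ℕ.≤-reflexive (cong₂ _+_ (sym (δ-refl i)) (sym (updateAt-updates i (R v)))))
        (ℕ.m≤n⇒m≤o+n (δ i j) (ℕ.≤-reflexive (sym (updateAt-minimal j i (R v) j≢i))))))

    unmarked-step : ∀ {j₀ t} → j ≤ j₀ → Admissible w (i , j₀) t →
                    ∃[ t′ ] Admissible v (i , j) t′ × (R w [ i ↦ t ]) ⊴ (R v [ i ↦ t′ ])
    unmarked-step j≤j₀ adm with R-keep j≤j₀ adm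
    ... | t′ , adm′ , keep = t′ , adm′ , ⊴-transfer i<j
      (λ k k≢i → subst (ℕ._≤ _) (sym (updateAt-minimal k i (R w) k≢i)) (R-other k k≢i))
      (subst₂ ℕ._≤_
        (cong₂ _+_ (sym (updateAt-updates i (R w))) (sym (updateAt-minimal j i (R w) j≢i)))
        (cong₂ _+_ (sym (updateAt-updates i (R v))) (sym (updateAt-minimal j i (R v) j≢i))) keep)

-- The remaining links only permute values right of `p`, so an ascent at `p` would leave one in
-- `w₀`, which has none.
finished : (w : Permutation′ n) (ls : List (Link n)) → All (λ l → proj₁ l < proj₂ l) ls →
           Saturated w ls → ∀ {p} → All (λ l → p < proj₁ l) ls → ∀ q → ¬ Ascent w p q
finished {n} w [] _ w≈w₀ {p} _ q (p<q , wp<wq) = ℕ.<⇒≱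
  (subst₂ ℕ._<_ (value p) (value q) wp<wq) (ℕ.∸-monoʳ-≤ n (s≤s (ℕ.<⇒≤ p<q)))
  where
  value : ∀ k → toℕ (w ! k) ≡ n ∸ suc (toℕ k)
  value k = trans (cong toℕ (w≈w₀ k)) (Fin.opposite-prop k)
finished w ((a , b) ∷ ls) (a<b ∷ ord) (_ , sat) {p} (p<a ∷ p<) q (p<q , wp<wq) =
  by-cases (q ≟ a) (q ≟ b)
  where
  p<b = Fin.<-trans p<a a<b
  v = w · (a , b)
  none = finished v ls ord sat p<
  vp = ·-other w (Fin.<⇒≢ p<a) (Fin.<⇒≢ p<b)
  by-cases : Dec (q ≡ a) → Dec (q ≡ b) → _
  by-cases (yes refl) _ = none b (p<b , subst₂ _<_ (sym vp) (sym (·-snd w a b)) wp<wq)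
  by-cases (no _) (yes refl) = none a (p<a , subst₂ _<_ (sym vp) (sym (·-fst w a b)) wp<wq)
  by-cases (no q≢a) (no q≢b) = none q (p<q , subst₂ _<_ (sym vp) (sym (·-other w q≢a q≢b)) wp<wq)

R≡0-before : (w : Permutation′ n) (i j : Fin n) (ls : List (Link n)) →
             All (λ l → proj₁ l < proj₂ l) ((i , j) ∷ ls) → Saturated w ((i , j) ∷ ls) →
             Linked (λ l l′ → proj₁ l ≤ proj₁ l′) ((i , j) ∷ ls) → ∀ p → p < i → R w p ≡ 0
R≡0-before w i j ls ord sat climb p p<i = R≡0 w (finished w _ ord sat
  (All.map (ℕ.<-≤-trans p<i) (Linked⇒All ℕ.≤-trans {v = i , j} ℕ.≤-refl climb)))

-- Induction along the chain, with the surplus `t` in place of `R` at the current position.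
markedAfter-lower : (w : Permutation′ n) (l : Link n) (ls : List (Link n)) {t : ℕ} →
                    All (λ l → proj₁ l < proj₂ l) ls → Saturated w ls →
                    Linked (λ l l′ → proj₁ l ≤ proj₁ l′) (l ∷ ls) → Admissible w l t →
                    (R w [ proj₁ l ↦ t ]) ⊴ count (markedAfter l ls)
markedAfter-lower w l@(i , j) [] ord sat climb adm = ⊴-pointwise λ k →
  ℕ.≤-trans (↦-≤ (Admissible⇒≤R w {j = j} adm) k)
            (ℕ.≤-reflexive (R≡0 w (finished w [] [] sat [])))
markedAfter-lower w l@(i₀ , j₀) (l′@(i , j) ∷ ls) (i<j ∷ ord) sat@(cover , sat′) (i₀≤i ∷ climb) adm
  with marks? l l′
... | yes _ with CoverStep.marked-step w i<j cover (R≡0-before w i j ls (i<j ∷ ord) sat climb)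
-- A mark closes the old account: the surplus is first replaced by the larger `R w i₀`.
...   | t′ , adm′ , R⊴ = ⊴-trans (⊴-pointwise (↦-≤ (Admissible⇒≤R w {j = j₀} adm)))
  (⊴-trans R⊴ (⊴-trans (⊴-+ˡ (δ i) (markedAfter-lower _ l′ ls ord sat′ climb adm′))
    (⊴-pointwise λ k → ℕ.≤-reflexive (sym (count-∷ l′ (markedAfter l′ ls) k)))))
-- Without a mark, `i` equals `i₀` and `j` is at most `j₀`.
markedAfter-lower w l@(i₀ , j₀) (l′@(i , j) ∷ ls) (i<j ∷ ord) sat@(cover , sat′) (i₀≤i ∷ climb) adm
    | no unmarked with toℕ-injective (ℕ.≤-antisym i₀≤i (ℕ.≮⇒≥ (unmarked ∘ inj₁)))
...   | refl with CoverStep.unmarked-step w i<j cover (R≡0-before w i j ls (i<j ∷ ord) sat climb)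
                    (ℕ.≮⇒≥ λ j₀<j → unmarked (inj₂ (refl , j₀<j))) adm
...     | t′ , adm′ , R⊴ = ⊴-trans R⊴ (markedAfter-lower _ l′ ls ord sat′ climb adm′)

M-lower : {w : Permutation′ n} (C : ClimbingChain w) → R w ⊴ count (M C)
M-lower {w = w} record { links = [] ; saturated = sat } =
  ⊴-pointwise λ k → ℕ.≤-reflexive (R≡0 w (finished w [] [] sat []))
M-lower {w = w} record { links     = l@(i , j) ∷ ls
                       ; ordered   = ord@(i<j ∷ ord′)
                       ; climbing  = climb
                       ; saturated = sat@(cover , sat′)
                       }
  with CoverStep.marked-step w i<j cover (R≡0-before w i j ls ord sat climb)
... | t , adm , R⊴ = ⊴-trans R⊴ (⊴-trans (⊴-+ˡ (δ i) (markedAfter-lower _ l ls ord′ sat′ climb adm))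
  (⊴-pointwise λ k → ℕ.≤-reflexive (sym (count-∷ l (markedAfter l ls) k))))

-- The greedy chain

extremal : {_⊏_ : Rel (Fin n) 0ℓ} → WellFounded _⊏_ → Decidable _⊏_ →
           {P : Fin n → Set} → Unary.Decidable P → ∃[ k ] P k →
           ∃[ k ] P k × (∀ p → p ⊏ k → ¬ P p)
extremal {n} {_⊏_} wf _⊏?_ {P} P? (k , Pk) = go Pk (wf k)
  where
  go : ∀ {k} → P k → Acc _⊏_ k → ∃[ k ] P k × (∀ p → p ⊏ k → ¬ P p)
  go {k} Pk (acc rs) with any? (λ p → (p ⊏? k) ×-dec P? p)
  ... | yes (p , p⊏k , Pp) = go Pp (rs p⊏k)
  ... | no none            = k , Pk , λ p p⊏k Pp → none (p , p⊏k , Pp)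

-- With `b` equal to `n`, this and `decreasing-lower` force the values of `w₀`.
decreasing-upper : ∀ {n b} {f : Fin n → ℕ} → (∀ {i j} → i < j → f j ℕ.< f i) → (∀ k → f k ℕ.< b) →
                   ∀ k → f k + suc (toℕ k) ℕ.≤ b
decreasing-upper {suc n} {b} {f} dec f<b zero    = subst (ℕ._≤ b) (ℕ.+-comm 1 (f zero)) (f<b zero)
decreasing-upper {suc n} {b} {f} dec f<b (suc k) =
  subst (ℕ._≤ b) (sym (ℕ.+-suc (f (suc k)) _))
    (ℕ.≤-<-trans (decreasing-upper {f = f ∘ suc} (dec ∘ s≤s) (λ k → dec (s≤s z≤n)) k) (f<b zero))

decreasing-lower : ∀ {n} {f : Fin n → ℕ} → (∀ {i j} → i < j → f j ℕ.< f i) →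
                   ∀ k → n ℕ.≤ f k + suc (toℕ k)
decreasing-lower {suc zero}    {f} dec zero = subst (1 ℕ.≤_) (ℕ.+-comm 1 (f zero)) (s≤s z≤n)
decreasing-lower {suc (suc n)} {f} dec zero =
  subst (suc (suc n) ℕ.≤_) (ℕ.+-comm 1 (f zero))
    (s≤s (ℕ.≤-trans (decreasing-lower {f = f ∘ suc} (dec ∘ s≤s) zero)
      (ℕ.≤-trans (ℕ.≤-reflexive (ℕ.+-comm (f (suc zero)) 1)) (dec (s≤s z≤n)))))
decreasing-lower {suc n} {f} dec (suc k) = subst (suc n ℕ.≤_) (sym (ℕ.+-suc (f (suc k)) _))
  (s≤s (decreasing-lower {f = f ∘ suc} (dec ∘ s≤s) k))

no-ascent⇒w₀ : (w : Permutation′ n) → (∀ i j → ¬ Ascent w i j) → w ≈ w₀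
no-ascent⇒w₀ {n} w none k = toℕ-injective (trans value (sym (Fin.opposite-prop k)))
  where
  dec : ∀ {i j} → i < j → w ! j < w ! i
  dec {i} {j} i<j = ≮∧≢⇒> (λ wi<wj → none i j (i<j , wi<wj)) (Fin.<⇒≢ i<j ∘ !-injective w)
  value : toℕ (w ! k) ≡ n ∸ suc (toℕ k)
  value = trans (sym (ℕ.m+n∸n≡m _ (suc (toℕ k)))) (cong (_∸ suc (toℕ k))
    (ℕ.≤-antisym (decreasing-upper dec (λ k → toℕ<n (w ! k)) k) (decreasing-lower dec k)))

R≡0⇒no-ascent : (w : Permutation′ n) {i : Fin n} → R w i ≡ 0 → ∀ k → ¬ Ascent w i k
R≡0⇒no-ascent w eq k asc = ℕ.n≮0 (subst (R w k ℕ.<_) eq (R-ascent w asc))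

record GreedyLink (w : Permutation′ n) (i j : Fin n) : Set where
  field
    ascent    : Ascent w i j
    tight     : R w i ≡ suc (R w j)
    first     : ∀ p → p < i → R w p ≡ 0
    rightmost : ∀ k → j < k → Ascent w i k → R w i ≢ suc (R w k)

greedyLink : (w : Permutation′ n) → w ≈ w₀ ⊎ ∃[ i ] ∃[ j ] GreedyLink w i j
greedyLink w with any? (λ i → ¬? (R w i ℕ.≟ 0))
... | no none = inj₁ (no-ascent⇒w₀ w λ i →
  R≡0⇒no-ascent w (decidable-stable (R w i ℕ.≟ 0) λ R≢0 → none (i , R≢0)))
... | yes some with extremal <-wellFounded _<?_ (λ i → ¬? (R w i ℕ.≟ 0)) some
...   | i , R≢0 , low with R-next w i
...     | inj₁ eq = contradiction eq R≢0
...     | inj₂ next with extremal >-wellFounded (flip _<?_)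
                           (λ k → ascent? w i k ×-dec (R w i ℕ.≟ suc (R w k))) next
...       | j , (asc , eq) , last = inj₂ (i , j , record
  { ascent    = asc
  ; tight     = eq
  ; first     = λ p p<i → decidable-stable (R w p ℕ.≟ 0) (low p p<i)
  ; rightmost = λ k j<k asc eq → last k j<k (asc , eq)
  })

-- Termination measure for the greedy construction.
energy : Permutation′ n → ℕ
energy w = total λ k → toℕ k * toℕ (w ! k)

energy-drops : (w : Permutation′ n) {i j : Fin n} → Ascent w i j → energy (w · (i , j)) ℕ.< energy w
energy-drops w {i} {j} (i<j , wi<wj) = total-transfer {a = 1} i<j
  (λ k k≢i k≢j → ℕ.≤-reflexive (cong (λ a → toℕ k * toℕ a) (·-other w k≢i k≢j)))
  (subst₂ (λ a b → suc (toℕ i * toℕ a + toℕ j * toℕ b) ℕ.≤ toℕ i * toℕ (w ! i) + toℕ j * toℕ (w ! j))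
    (sym (·-fst w i j)) (sym (·-snd w i j))
    (subst₂ ℕ._<_ (ℕ.+-comm (toℕ j * toℕ (w ! i)) _) (ℕ.+-comm (toℕ j * toℕ (w ! j)) _)
      (subst (toℕ j * toℕ (w ! i) + toℕ i * toℕ (w ! j) ℕ.<_) (rearrange (ℕ.<⇒≤ i<j) (ℕ.<⇒≤ wi<wj))
        (ℕ.+-monoˡ-≤ _ (ℕ.*-mono-≤ (ℕ.m<n⇒0<n∸m i<j) (ℕ.m<n⇒0<n∸m wi<wj))))))

-- A bound t on the number of further marks at position i after a link (i , j).
Bounded : Permutation′ n → Link n → ℕ → Set
Bounded w (i , j) t = R w i ℕ.≤ suc t × (∀ k → j < k → Ascent w i k → R w k ℕ.< t)

module GreedyStep (w : Permutation′ n) {i j : Fin n} (greedy : GreedyLink w i j) where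
  open GreedyLink greedy

  private
    v = w · (i , j)
    i<j = proj₁ ascent
    wi<wj = proj₂ ascent

  -- A point between the corners would give `R w i` at least two more than `R w j`, against `tight`.
  cover : w ⋖ v
  cover = ¬between⇒⋖ w i<j wi<wj λ k ((i<k , k<j) , (wi<wk , wk<wj)) →
    ℕ.<⇒≱ (ℕ.<-≤-trans (s≤s (R-ascent w (k<j , wk<wj))) (R-ascent w (i<k , wi<wk)))
           (ℕ.≤-reflexive tight)

  ascent-before⁻ : ∀ {p k} → p < i → Ascent v p k → ∃[ q ] Ascent w p q
  ascent-before⁻ {p} {k} p<i (p<k , vp<vk) = by-cases (k ≟ i) (k ≟ j)
    where
    p<j = Fin.<-trans p<i i<j
    vp = ·-other w (Fin.<⇒≢ p<i) (Fin.<⇒≢ p<j)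
    by-cases : Dec (k ≡ i) → Dec (k ≡ j) → ∃[ q ] Ascent w p q
    by-cases (yes refl) _        = j , p<j , subst₂ _<_ vp (·-fst w i j) vp<vk
    by-cases (no _) (yes refl)   = i , p<i , subst₂ _<_ vp (·-snd w i j) vp<vk
    by-cases (no k≢i) (no k≢j)   = k , p<k , subst₂ _<_ vp (·-other w k≢i k≢j) vp<vk

  ascent-at⁻ : ∀ {k} → Ascent v i k → k ≢ j × Ascent w i k
  ascent-at⁻ {k} (i<k , vi<vk) = k≢j , i<k , Fin.<-trans wi<wj
    (subst₂ _<_ (·-fst w i j) (·-other w (Fin.<⇒≢ i<k ∘ sym) k≢j) vi<vk)
    where
    k≢j : k ≢ j
    k≢j refl = Fin.<-asym wi<wj (subst₂ _<_ (·-fst w i j) (·-snd w i j) vi<vk)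

  ascent-after⁻ : ∀ {p k} → i < p → p ≢ j → Ascent v p k → Ascent w p k
  ascent-after⁻ {p} {k} i<p p≢j (p<k , vp<vk) = p<k , by-cases (k ≟ j)
    where
    vp = ·-other w (Fin.<⇒≢ i<p ∘ sym) p≢j
    by-cases : Dec (k ≡ j) → w ! p < w ! k
    by-cases (yes refl) = Fin.<-trans (subst₂ _<_ vp (·-snd w i j) vp<vk) wi<wj
    by-cases (no k≢j)   = subst₂ _<_ vp (·-other w (Fin.<⇒≢ (Fin.<-trans i<p p<k) ∘ sym) k≢j) vp<vk

  ascent-j⁻ : ∀ {k} → Ascent v j k → Ascent w i k
  ascent-j⁻ {k} (j<k , vj<vk) = Fin.<-trans i<j j<k ,
    subst₂ _<_ (·-snd w i j) (·-other w (Fin.<⇒≢ (Fin.<-trans i<j j<k) ∘ sym) (Fin.<⇒≢ j<k ∘ sym)) vj<vk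

  -- By `tight`, `R w k` is at most `R w j`; equality would make `k` a tight choice further right.
  R-right : ∀ {k} → j < k → Ascent w i k → R w k ℕ.< R w j
  R-right {k} j<k asc = ℕ.≤∧≢⇒<
    (ℕ.s≤s⁻¹ (subst (R w k ℕ.<_) tight (R-ascent w asc)))
    (λ eq → rightmost k j<k asc (trans tight (cong suc (sym eq))))

  -- Beyond `i` only `j` can gain ascents, as its value drops to `w ! i`. Their targets are ascents
  -- from `i` in `w`, which `R-right` controls.
  R-after : ∀ {p} → i < p → R v p ℕ.≤ R w p
  R-after {p} = go (>-wellFounded p)
    where
    go : ∀ {p} → Acc (λ a b → b < a) p → i < p → R v p ℕ.≤ R w p
    go {p} (acc rs) i<p with R-next v p
    ... | inj₁ eq = subst (ℕ._≤ R w p) (sym eq) z≤n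
    ... | inj₂ (k , asc@(p<k , _) , eq) = subst (ℕ._≤ R w p) (sym eq)
      (ℕ.≤-<-trans (go (rs p<k) (Fin.<-trans i<p p<k)) (below (p ≟ j)))
      where
      below : Dec (p ≡ j) → R w k ℕ.< R w p
      below (yes refl) = R-right p<k (ascent-j⁻ asc)
      below (no p≢j)   = R-ascent w (ascent-after⁻ i<p p≢j asc)

  R-shrinks : ∀ p → R v p ℕ.≤ R w p
  R-shrinks p with Fin.<-cmp p i
  ... | tri> _ _ i<p = R-after i<p
  ... | tri< p<i _ _ = subst (ℕ._≤ R w p) (sym (R≡0 v λ k asc →
    R≡0⇒no-ascent w (first p p<i) _ (proj₂ (ascent-before⁻ p<i asc)))) z≤n
  ... | tri≈ _ refl _ with R-next v i
  ...   | inj₁ eq = subst (ℕ._≤ R w i) (sym eq) z≤n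
  ...   | inj₂ (k , asc , eq) = subst (ℕ._≤ R w i) (sym eq)
    (ℕ.≤-<-trans (R-after (proj₁ asc)) (R-ascent w (proj₂ (ascent-at⁻ asc))))

  bounded : Bounded v (i , j) (R w j)
  bounded = ℕ.≤-trans (R-shrinks i) (ℕ.≤-reflexive tight) , λ k j<k asc →
    ℕ.≤-<-trans (R-after (Fin.<-trans i<j j<k)) (R-right j<k (proj₂ (ascent-at⁻ asc)))

  first′ : ∀ p → p < i → R v p ≡ 0
  first′ p p<i = ℕ.n≤0⇒n≡0 (subst (R v p ℕ.≤_) (first p p<i) (R-shrinks p))

  marked-bound : ∀ k → δ i k + (R v [ i ↦ R w j ]) k ℕ.≤ R w k
  marked-bound k with i ≟ k
  ... | yes refl = ℕ.≤-reflexive (trans (cong suc (updateAt-updates i (R v))) (sym tight))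
  ... | no i≢k   = subst (ℕ._≤ R w k) (sym (updateAt-minimal k i (R v) (i≢k ∘ sym))) (R-shrinks k)

  -- By `tight`, the bound `R w i ℕ.≤ suc t` says that `R w j` is at most `t`, so the new bound is
  -- no weaker.
  unmarked-bound : ∀ {t} → R w i ℕ.≤ suc t → ∀ k → (R v [ i ↦ R w j ]) k ℕ.≤ (R w [ i ↦ t ]) k
  unmarked-bound {t} Ri≤ k with k ≟ i
  ... | yes refl = subst₂ ℕ._≤_ (sym (updateAt-updates i (R v))) (sym (updateAt-updates i (R w)))
    (ℕ.s≤s⁻¹ (subst (ℕ._≤ suc t) tight Ri≤))
  ... | no k≢i   = subst₂ ℕ._≤_ (sym (updateAt-minimal k i (R v) k≢i))
    (sym (updateAt-minimal k i (R w) k≢i)) (R-shrinks k)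

↦-≥ : {f : Fin n → ℕ} {i : Fin n} {t : ℕ} → f i ℕ.≤ t → ∀ k → f k ℕ.≤ (f [ i ↦ t ]) k
↦-≥ {f = f} {i} ≤t k with k ≟ i
... | yes refl = subst (f i ℕ.≤_) (sym (updateAt-updates i f)) ≤t
... | no  k≢i  = ℕ.≤-reflexive (sym (updateAt-minimal k i f k≢i))

-- The preceding link `l` is kept because it decides whether the first link of `rest` is marked.
record Continuation (w : Permutation′ n) (l : Link n) (t : ℕ) : Set where
  field
    rest           : List (Link n)
    rest-ordered   : All (λ l → proj₁ l < proj₂ l) rest
    rest-climbing  : Linked (λ l l′ → proj₁ l ≤ proj₁ l′) (l ∷ rest)
    rest-saturated : Saturated w rest
    rest-upper     : ∀ k → count (markedAfter l rest) k ℕ.≤ (R w [ proj₁ l ↦ t ]) k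

continuation : (w : Permutation′ n) (l : Link n) {t : ℕ} → (∀ p → p < proj₁ l → R w p ≡ 0) →
               Bounded w l t → Acc ℕ._<_ (energy w) → Continuation w l t
continuation w l@(i₀ , j₀) {t} low (R≤ , right<) (acc rs) with greedyLink w
... | inj₁ w≈w₀ = record
  { rest           = []
  ; rest-ordered   = []
  ; rest-climbing  = [-]
  ; rest-saturated = w≈w₀
  ; rest-upper     = λ _ → z≤n
  }
... | inj₂ (i , j , greedy) = record
  { rest           = l′ ∷ rest
  ; rest-ordered   = proj₁ ascent ∷ rest-ordered
  ; rest-climbing  = i₀≤i ∷ rest-climbing
  ; rest-saturated = cover , rest-saturated
  ; rest-upper     = upper
  }
  where
  open GreedyLink greedy
  open GreedyStep w greedy
  l′ = i , j
  open Continuation (continuation (w · l′) l′ first′ bounded (rs (energy-drops w ascent)))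
  -- Positions before `i₀` have `R` zero, while `tight` makes `R w i` positive.
  i₀≤i : i₀ ≤ i
  i₀≤i = ℕ.≮⇒≥ λ i<i₀ → ℕ.0≢1+n (trans (sym (low i i<i₀)) tight)
  upper : ∀ k → count (markedAfter l (l′ ∷ rest)) k ℕ.≤ (R w [ i₀ ↦ t ]) k
  upper k with marks? l l′
  ... | yes marked = ℕ.≤-trans (ℕ.≤-reflexive (count-∷ l′ (markedAfter l′ rest) k))
    (ℕ.≤-trans (ℕ.+-monoʳ-≤ (δ i k) (rest-upper k))
      (ℕ.≤-trans (marked-bound k) (↦-≥ (R₀≤t marked) k)))
    where
    R₀≤t : Marks l l′ → R w i₀ ℕ.≤ t
    R₀≤t (inj₁ i₀<i)         = subst (ℕ._≤ t) (sym (first i₀ i₀<i)) z≤n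
    -- A new mark at the same position uses some `j` beyond `j₀`, where `Bounded` gives `R w j`
    -- below `t`.
    R₀≤t (inj₂ (refl , j₀<j)) = subst (ℕ._≤ t) (sym tight) (right< j j₀<j ascent)
  ... | no unmarked with toℕ-injective (ℕ.≤-antisym i₀≤i (ℕ.≮⇒≥ (unmarked ∘ inj₁)))
  ...   | refl = ℕ.≤-trans (rest-upper k) (unmarked-bound R≤ k)

greedyChain : (w : Permutation′ n) → ∃[ C ] (∀ k → count (M {w = w} C) k ℕ.≤ R w k)
greedyChain w with greedyLink w
... | inj₁ w≈w₀ = record
  { links = [] ; ordered = [] ; climbing = [] ; saturated = w≈w₀ } , λ _ → z≤n
... | inj₂ (i , j , greedy) = record
  { links     = (i , j) ∷ rest
  ; ordered   = proj₁ ascent ∷ rest-ordered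
  ; climbing  = rest-climbing
  ; saturated = cover , rest-saturated
  } , λ k → ℕ.≤-trans (ℕ.≤-reflexive (count-∷ (i , j) (markedAfter (i , j) rest) k))
    (ℕ.≤-trans (ℕ.+-monoʳ-≤ (δ i k) (rest-upper k)) (marked-bound k))
  where
  open GreedyLink greedy
  open GreedyStep w greedy
  open Continuation (continuation (w · (i , j)) (i , j) first′ bounded (ℕ.<-wellFounded _))

-- Marks and links of a climbing chain

total-0 : ∀ n → total {n} (const 0) ≡ 0
total-0 zero    = refl
total-0 (suc n) = total-0 n

δ-suc : (i k : Fin n) → δ (suc i) (suc k) ≡ δ i k
δ-suc i k = ⟦⟧-cong (suc i ≟ suc k) (i ≟ k) Fin.suc-injective (cong suc)

total-δ : (i : Fin n) → total (δ i) ≡ 1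
total-δ {suc n} zero    = cong suc (total-0 n)
total-δ {suc n} (suc i) = trans (total-cong (δ-suc i)) (total-δ i)

total-count : (ls : List (Link n)) → total (count ls) ≡ length ls
total-count {n} []  = total-0 n
total-count (l ∷ ls) = trans (total-cong (count-∷ l ls))
  (trans (total-+ (δ (proj₁ l)) (count ls)) (cong₂ _+_ (total-δ (proj₁ l)) (total-count ls)))

count-markedAfter : (l : Link n) (ls : List (Link n)) (k : Fin n) →
                    count (markedAfter l ls) k ℕ.≤ count ls k
count-markedAfter l []        k = z≤n
count-markedAfter l (l′ ∷ ls) k with marks? l l′
... | yes _ = subst₂ ℕ._≤_ (sym (count-∷ l′ (markedAfter l′ ls) k)) (sym (count-∷ l′ ls k))
  (ℕ.+-monoʳ-≤ (δ (proj₁ l′) k) (count-markedAfter l′ ls k))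
... | no  _ = subst (count (markedAfter l′ ls) k ℕ.≤_) (sym (count-∷ l′ ls k))
  (ℕ.m≤n⇒m≤o+n (δ (proj₁ l′) k) (count-markedAfter l′ ls k))

count-marked : (ls : List (Link n)) (k : Fin n) → count (markedLinks ls) k ℕ.≤ count ls k
count-marked []       k = z≤n
count-marked (l ∷ ls) k = subst₂ ℕ._≤_ (sym (count-∷ l (markedAfter l ls) k)) (sym (count-∷ l ls k))
  (ℕ.+-monoʳ-≤ (δ (proj₁ l) k) (count-markedAfter l ls k))

-- Every link (k , ⋆) raises the value at position k, which ends as n ∸ suc (toℕ k).
count-value : (w : Permutation′ n) (ls : List (Link n)) → All (λ l → proj₁ l < proj₂ l) ls →
              Saturated w ls → ∀ k → All (λ l → k ≤ proj₁ l) ls →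
              count ls k + toℕ (w ! k) ℕ.≤ n ∸ suc (toℕ k)
count-value w [] _ w≈w₀ k _ = ℕ.≤-reflexive (trans (cong toℕ (w≈w₀ k)) (Fin.opposite-prop k))
count-value {n} w ((i , j) ∷ ls) (i<j ∷ ord) (cover , sat) k (k≤i ∷ k≤) =
  ℕ.≤-trans (subst (λ c → c + toℕ (w ! k) ℕ.≤ count ls k + toℕ (v ! k)) (sym (count-∷ (i , j) ls k)) raise)
            (count-value v ls ord sat k k≤)
  where
  v = w · (i , j)
  raise : δ i k + count ls k + toℕ (w ! k) ℕ.≤ count ls k + toℕ (v ! k)
  raise with i ≟ k
  ... | yes refl = subst (ℕ._≤ count ls k + toℕ (v ! k)) (ℕ.+-suc (count ls k) (toℕ (w ! k)))
    (ℕ.+-monoʳ-≤ (count ls k)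
      (subst (λ a → toℕ (w ! i) ℕ.< toℕ a) (sym (·-fst w i j)) (⋖⇒ascent w i<j cover)))
  ... | no i≢k = ℕ.+-monoʳ-≤ (count ls k)
    (ℕ.≤-reflexive (cong toℕ (sym (·-other w (i≢k ∘ sym) (Fin.<⇒≢ (ℕ.≤-<-trans k≤i i<j))))))

-- Initial links at positions before `k` do not count at `k`; once they are dropped, `count-value`
-- applies.
count-links : (w : Permutation′ n) (ls : List (Link n)) → All (λ l → proj₁ l < proj₂ l) ls →
              Linked (λ l l′ → proj₁ l ≤ proj₁ l′) ls → Saturated w ls →
              ∀ k → count ls k ℕ.≤ n ∸ suc (toℕ k)
count-links w [] _ _ _ k = z≤n
count-links {n} w ls@((i , j) ∷ ls′) ord climb sat k with i <? k
... | yes i<k = subst (ℕ._≤ n ∸ suc (toℕ k)) (sym count≡)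
  (count-links (w · (i , j)) ls′ (All.tail ord) (Linked.tail climb) (proj₂ sat) k)
  where
  count≡ : count ls k ≡ count ls′ k
  count≡ with i ≟ k
  ... | yes i≡k = contradiction i≡k (Fin.<⇒≢ i<k)
  ... | no  _   = refl
... | no i≮k = ℕ.≤-trans (ℕ.m≤m+n _ _) (count-value w ls ord sat k
  (Linked⇒All ℕ.≤-trans {v = k , j} (ℕ.≮⇒≥ i≮k) climb))

count-M : {w : Permutation′ n} (C : ClimbingChain w) → ∀ k → count (M C) k ℕ.≤ n ∸ suc (toℕ k)
count-M {w = w} C k = ℕ.≤-trans (count-marked (links C) k)
  (count-links w (links C) (ordered C) (climbing C) (saturated C) k)

theorem8p6 : ∀ {ℓ} n (w : Permutation′ n) (T : TermOrder n ℓ) →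
    (∀ {i j} → i < j → TermOrder._≺_ T (x i) (x j)) →
    IsMin (TermOrder._≼_ T) (heavyDualWeights w) (dualRajcode w) × IsMax (TermOrder._≼_ T) (heavyWeights w) (rajcode w)
theorem8p6 n w T x-mono =
  ((C₀ , C₀-heavy , dualRajcode≡) , λ { _ (C , heavy , refl) → below C heavy }) ,
  ((C₀ , C₀-heavy , cong complement dualRajcode≡) ,
   λ { _ (C , heavy , refl) → complement-anti T R≤stairs (count-M C) (below C heavy) })
  where
  open TermOrder T
  C₀ = proj₁ (greedyChain w)
  -- The greedy bound holds pointwise and `M-lower` reverses it for the totals, which forces
  -- equality.
  count≡R : ∀ k → count (M C₀) k ≡ R w k
  count≡R = pointwise-≡ (proj₂ (greedyChain w)) (⊴-total (M-lower C₀))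
  C₀-heavy : Heavy C₀
  C₀-heavy = trans (sym (total-count (M C₀))) (total-cong count≡R)
  dualRajcode≡ : dualRajcode w ≡ dualWeight (M C₀)
  dualRajcode≡ = tabulate-cong (sym ∘ count≡R)
  -- The greedy chain realises `R`, so the bound on the links of a chain passes to `R`.
  R≤stairs : ∀ k → R w k ℕ.≤ n ∸ suc (toℕ k)
  R≤stairs k = subst (ℕ._≤ n ∸ suc (toℕ k)) (count≡R k) (count-M C₀ k)
  -- Heaviness supplies the equality of totals that comparing suffix sums requires.
  below : (C : ClimbingChain w) → Heavy C → dualRajcode w ≼ dualWeight (M C)
  below C heavy = ⊴⇒≼ T (proj₁ ∘ x-mono) (trans (sym heavy) (sym (total-count (M C)))) (M-lower C)
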